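{- For any constant $t\in\mathbb{N}$ there exists a constant $C=C(t)$ such that the following holds. Let $k<n/C$, and let $\mathcal{F}_1,\dots,\mathcal{F}_t\subseteq\binom{[n]}{k}$ be families that are cross free of a matching, i.e. there are no pairwise disjoint sets $A_1\in\mathcal{F}_1,\dots,A_t\in\mathcal{F}_t$. Then \[ \min_{i\in[t]}|\mathcal{F}_i|\le\binom{n}{k}-\binom{n-t+1}{k}, \] with equality if and only if there exists a $(t-1,1)$-star $\mathcal{U}$ such that $\mathcal{F}_1=\dots=\mathcal{F}_t=\mathcal{U}$.
   Context: A $(t-1,1)$-star is a family of the form $\{A\in\binom{[n]}{k}:A\cap U\neq\emptyset\}$ for some $U\in\binom{[n]}{t-1}$.
   Formalization: The formal statement assumes k ≥ 1: for k = 0 and t = 2 the families {∅} and the empty family are cross free of a matching and attain equality (0 = 0), but they are not both equal to a (t-1,1)-star. -}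

module Defs where

open import Data.Nat using (ℕ; zero; suc; _⊓_)
open import Data.Bool using (Bool; true; false; if_then_else_)
open import Data.List using (List; []; _∷_; map; _++_)
open import Data.Vec using (_∷_; [])
open import Data.Fin using (Fin; zero; suc)
open import Data.Fin.Subset using (Subset; _∩_; Empty; ∣_∣; Nonempty; inside; outside)
open import Data.Product using (∃; _×_)
open import Relation.Binary.PropositionalEquality using (_≡_; _≢_)

allSubsets : (n : ℕ) → List (Subset n)
allSubsets zero = [] ∷ []
allSubsets (suc n) = map (outside ∷_) (allSubsets n) ++ map (inside ∷_) (allSubsets n)

Family : ℕ → Set
Family n = Subset n → Bool

count : ∀ {n} → Family n → List (Subset n) → ℕ
count F [] = zero
count F (A ∷ As) = if F A then suc (count F As) else count F As

∣_∣ᶠ : ∀ {n} → Family n → ℕ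
∣ F ∣ᶠ = count F (allSubsets _)

IsUniform : ∀ {n} → ℕ → Family n → Set
IsUniform {n} k F = ∀ (A : Subset n) → F A ≡ true → ∣ A ∣ ≡ k

CrossFreeOfMatching : ∀ {t n} → (Fin t → Family n) → Set
CrossFreeOfMatching {t} {n} F =
  ¬' (∃ λ (A : Fin t → Subset n) →
        (∀ i → F i (A i) ≡ true) ×
        (∀ i j → i ≢ j → Empty (A i ∩ A j)))
  where
  open import Relation.Nullary using (¬_)
  ¬' : Set → Set
  ¬' P = ¬ P

IsStarOf : ∀ {n} → ℕ → Subset n → Family n → Set
IsStarOf {n} k U F = ∀ (A : Subset n) →
  (F A ≡ true → ∣ A ∣ ≡ k × Nonempty (A ∩ U)) ×
  (∣ A ∣ ≡ k × Nonempty (A ∩ U) → F A ≡ true)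

-- minimum of f over i ∈ [t] (t ≥ 1; value 0 for t = 0 is irrelevant)
minOver : (t : ℕ) → (Fin t → ℕ) → ℕ
minOver zero f = zero
minOver (suc zero) f = f zero
minOver (suc (suc t)) f = f zero ⊓ minOver (suc t) (λ i → f (suc i))

{-# OPTIONS --safe #-}
-- Shifting neighbouring coordinates preserves sizes and cross-freeness, and a family tuple whose
-- shift is a common star is itself one (unshift-star), so the families may be assumed shifted, i.e.
-- closed under moving elements to the left. Put U = [t-1], m = n-t+1, and let R j be the part of
-- F j avoiding U. A shifted family missing a set misses all sets that it dominates; hence if R j misses
-- the set "spread s" = {1,…,s} followed by every (c+1)-st element, its density is at most
-- X^-(sc+1), where X^-c is of the order of k/n: this is a ballot-type count. On the other
-- hand, if F j misses {u} ∪ (a "thread": every (c+1)-st element beyond s, k-1 in all), u ∈ U, it loses a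
-- proportion about 2^-s of the sets meeting U in u alone, which its size allows only if R j is as large.
-- By induction on s all these sets are in F j, and t-1 of them in distinct residue classes modulo c+1
-- form a cross-matching with spread s; so no R j contains spread s. For s = k this says that R j is empty.
module Submission where

open import Defs
open import Data.Bool using (Bool; true; false; _∧_; _∨_; not; T) renaming (_≟_ to _≟ᵇ_)
open import Data.Bool.Properties using (∧-zeroʳ; ∨-zeroʳ)
open import Data.Empty using (⊥-elim) renaming (⊥ to Absurd)
open import Data.Fin using (Fin; zero; suc; toℕ; fromℕ<; punchOut; punchIn)
open import Data.Fin.Properties using (any?; all?; ¬∀⟶∃¬; toℕ<n; toℕ-fromℕ<; toℕ-injective; punchOut-injective; punchInᵢ≢i) renaming (_≟_ to _≟ᶠ_; suc-injective to sucᶠ-injective)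
open import Data.Fin.Subset using (Subset; ∣_∣; ⊥; ⊤; ⁅_⁆; _∪_; _∩_; Nonempty)
open import Data.Fin.Subset.Properties using (∣p∣≤n; ∣⊥∣≡0; ∣⁅x⁆∣≡1; ∣⊤∣≡n; anySubset?)
open import Data.List using (map) renaming ([] to []ˡ; _∷_ to _∷ˡ_; _++_ to _++ˡ_)
open import Data.Nat
open import Data.Nat.Combinatorics using (_C_; nCk+nC[k+1]≡[n+1]C[k+1]; k>n⇒nCk≡0)
open import Data.Nat.Properties
open import Data.Nat.Tactic.RingSolver using (solve-∀)
open import Data.Product using (∃; _×_; _,_; proj₁; proj₂)
open import Data.Sum using (_⊎_; inj₁; inj₂)
open import Data.Unit using (tt) renaming (⊤ to Unit)
open import Data.Vec using ([]; _∷_; _++_; lookup)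
open import Data.Vec.Properties using (lookup-zipWith; lookup⇒[]=; []=⇒lookup)
open import Function using (_∘_)
open import Function.Bundles using (_⇔_; mk⇔)
open import Relation.Binary.PropositionalEquality
open import Relation.Nullary using (¬_; Dec; yes; no)
open import Relation.Nullary.Decidable using (_×-dec_)

-- Counting families

-- The ratio `n / k` is bounded only from below, so no fixed base of the exponential estimates will
-- do. A missing thread costs a share of the `h`-sets, `h = k - 1`, while `R j` is measured against
-- the `k`-sets, and these counts differ by a factor of about `m / k`. The base `X` is therefore
-- tied to that ratio: up to constants `X ^ c * k ≤ m ≤ κ * X ^ c * k`. The change from `k`-sets to
-- `h`-sets then costs `c` in the exponent, and excluding `spread s` saves `s * c + 1`. At `s = 1`
-- one factor `X` is left over; it has to beat `κ` and the `2 ^ 3` lost to the delay of the threads,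
-- whence `X > 8 * κ`. Every later step saves another `X ^ c` and costs one more factor 2. The
-- inequality has no proof of its own: families at least as large as a star are shown to be equal to
-- one star, which settles the bound and the equality case together.

bit : Bool → ℕ
bit true  = 1
bit false = 0

-- Recursion on the first coordinate, so that a family is studied through its two sections
-- `F ∘ (false ∷_)` and `F ∘ (true ∷_)`; all counting inductions below have this shape.
Sum : ∀ n → (Subset n → ℕ) → ℕ
Sum zero    g = g []
Sum (suc n) g = Sum n (g ∘ (false ∷_)) + Sum n (g ∘ (true ∷_))

Sum-mono : ∀ n {g h : Subset n → ℕ} → (∀ A → g A ≤ h A) → Sum n g ≤ Sum n h
Sum-mono zero    le = le []
Sum-mono (suc n) le = +-mono-≤ (Sum-mono n (le ∘ (false ∷_))) (Sum-mono n (le ∘ (true ∷_)))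

Sum-cong : ∀ n {g h : Subset n → ℕ} → (∀ A → g A ≡ h A) → Sum n g ≡ Sum n h
Sum-cong zero    eq = eq []
Sum-cong (suc n) eq = cong₂ _+_ (Sum-cong n (eq ∘ (false ∷_))) (Sum-cong n (eq ∘ (true ∷_)))

+-interchange : ∀ a b c d → (a + b) + (c + d) ≡ (a + c) + (b + d)
+-interchange = solve-∀

Sum-+ : ∀ n (g h : Subset n → ℕ) → Sum n (λ A → g A + h A) ≡ Sum n g + Sum n h
Sum-+ zero    g h = refl
Sum-+ (suc n) g h = trans (cong₂ _+_ (Sum-+ n _ _) (Sum-+ n _ _))
  (+-interchange (Sum n (g ∘ (false ∷_))) (Sum n (h ∘ (false ∷_))) (Sum n (g ∘ (true ∷_))) (Sum n (h ∘ (true ∷_))))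

Sum-zero : ∀ n → Sum n (λ _ → 0) ≡ 0
Sum-zero zero    = refl
Sum-zero (suc n) = cong₂ _+_ (Sum-zero n) (Sum-zero n)

card : ∀ {n} → Family n → ℕ
card {n} F = Sum n (bit ∘ F)

count-++ : ∀ {n} (F : Family n) xs ys → count F (xs ++ˡ ys) ≡ count F xs + count F ys
count-++ F []ˡ       ys = refl
count-++ F (x ∷ˡ xs) ys with F x
... | true  = cong suc (count-++ F xs ys)
... | false = count-++ F xs ys

count-map : ∀ {m n} (F : Family n) (f : Subset m → Subset n) xs → count F (map f xs) ≡ count (F ∘ f) xs
count-map F f []ˡ       = refl
count-map F f (x ∷ˡ xs) with F (f x)
... | true  = cong suc (count-map F f xs)
... | false = count-map F f xs

∣∣ᶠ≡card : ∀ {n} (F : Family n) → ∣ F ∣ᶠ ≡ card F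
∣∣ᶠ≡card {zero} F with F []
... | true  = refl
... | false = refl
∣∣ᶠ≡card {suc n} F = trans (count-++ F (map (false ∷_) (allSubsets n)) _)
  (cong₂ _+_ (trans (count-map F _ (allSubsets n)) (∣∣ᶠ≡card (F ∘ (false ∷_))))
             (trans (count-map F _ (allSubsets n)) (∣∣ᶠ≡card (F ∘ (true ∷_)))))

bit-mono : ∀ {a b} → (a ≡ true → b ≡ true) → bit a ≤ bit b
bit-mono {false} h = z≤n
bit-mono {true}  h rewrite h refl = ≤-refl

card-mono : ∀ {n} {F G : Family n} → (∀ A → F A ≡ true → G A ≡ true) → card F ≤ card G
card-mono {n} h = Sum-mono n (λ A → bit-mono (h A))

card-cong : ∀ {n} {F G : Family n} → (∀ A → F A ≡ G A) → card F ≡ card G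
card-cong {n} h = Sum-cong n (λ A → cong bit (h A))

card-false : ∀ {n} {F : Family n} → (∀ A → F A ≡ false) → card F ≡ 0
card-false {n} h = trans (card-cong h) (Sum-zero n)

card-split : ∀ {n} (F G : Family n) →
  card F ≡ card (λ A → F A ∧ G A) + card (λ A → F A ∧ not (G A))
card-split {n} F G = trans (Sum-cong n (λ A → lem (F A) (G A))) (Sum-+ n _ _)
  where
  lem : ∀ a b → bit a ≡ bit (a ∧ b) + bit (a ∧ not b)
  lem false b     = refl
  lem true  true  = refl
  lem true  false = refl

-- Slack in a single term would show in the total. This turns equality of sizes or weights into
-- equality of families.
Sum-squeeze : ∀ n {g h : Subset n → ℕ} → (∀ A → g A ≤ h A) → Sum n h ≤ Sum n g → ∀ A → h A ≤ g A
Sum-squeeze zero    g≤h le []          = le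
Sum-squeeze (suc n) {g} {h} g≤h le (false ∷ A) = Sum-squeeze n (g≤h ∘ (false ∷_))
  (+-cancelʳ-≤ (Sum n (h ∘ (true ∷_))) _ _ (≤-trans le (+-monoʳ-≤ (Sum n (g ∘ (false ∷_))) (Sum-mono n (g≤h ∘ (true ∷_)))))) A
Sum-squeeze (suc n) {g} {h} g≤h le (true ∷ A) = Sum-squeeze n (g≤h ∘ (true ∷_))
  (+-cancelˡ-≤ (Sum n (h ∘ (false ∷_))) _ _ (≤-trans le (+-monoˡ-≤ (Sum n (g ∘ (true ∷_))) (Sum-mono n (g≤h ∘ (false ∷_)))))) A

bit-mono⁻¹ : ∀ {a b} → bit a ≤ bit b → a ≡ true → b ≡ true
bit-mono⁻¹ {true} {true} _ _ = refl

card-full⇒⊇ : ∀ {n} (F G : Family n) → (∀ A → F A ≡ true → G A ≡ true) →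
  card G ≤ card F → ∀ A → G A ≡ true → F A ≡ true
card-full⇒⊇ {n} F G F⊆G le A = bit-mono⁻¹ (Sum-squeeze n (λ A → bit-mono (F⊆G A)) le A)

-- Binomial coefficients

binom : ℕ → ℕ → ℕ
binom n       zero    = 1
binom zero    (suc k) = 0
binom (suc n) (suc k) = binom n (suc k) + binom n k

nC0≡1 : ∀ n → n C 0 ≡ 1
nC0≡1 zero    = refl
nC0≡1 (suc n) = refl

binom≡C : ∀ n k → binom n k ≡ n C k
binom≡C n       zero    = sym (nC0≡1 n)
binom≡C zero    (suc k) = sym (k>n⇒nCk≡0 {zero} {suc k} (s≤s z≤n))
binom≡C (suc n) (suc k) = trans (+-comm (binom n (suc k)) _)
  (trans (cong₂ _+_ (binom≡C n k) (binom≡C n (suc k))) (nCk+nC[k+1]≡[n+1]C[k+1] n k))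

-- The rule `(k + 1) C(n, k + 1) = (n - k) C(n, k)`, with the subtraction moved across so that
-- `k > n` is no exception.
binom-absorb : ∀ n k → suc k * binom n (suc k) + k * binom n k ≡ n * binom n k
binom-absorb zero    zero    = refl
binom-absorb zero    (suc k) = cong₂ _+_ (*-zeroʳ k) (*-zeroʳ k)
binom-absorb (suc n) zero    = trans (arith (binom n 1)) (trans (cong suc (binom-absorb n zero)) (arith₂ n))
  where
  arith : ∀ x → x + 1 + 0 + 0 ≡ suc (x + 0 + 0)
  arith = solve-∀
  arith₂ : ∀ n → suc (n * 1) ≡ suc n * 1
  arith₂ = solve-∀
binom-absorb (suc n) (suc k) =
  trans (lhs k (binom n (suc (suc k))) (binom n (suc k)) (binom n k))
 (trans (cong₂ (λ u v → u + binom n (suc k) + (v + binom n k)) (binom-absorb n (suc k)) (binom-absorb n k))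
        (rhs n (binom n (suc k)) (binom n k)))
  where
  lhs : ∀ k a b c → suc (suc k) * (a + b) + suc k * (b + c)
      ≡ (suc (suc k) * a + suc k * b) + b + ((suc k * b + k * c) + c)
  lhs = solve-∀
  rhs : ∀ n b c → n * b + b + (n * c + c) ≡ suc n * (b + c)
  rhs = solve-∀

-- By `binom-absorb` the ratio of consecutive coefficients is `(m - k) / (k + 1)`, which the
-- hypothesis makes at least `Y`.
binom-ratio : ∀ Y m k → Y * suc k + k ≤ m → Y * binom m k ≤ binom m (suc k)
binom-ratio Y m k le = *-cancelˡ-≤ (suc k) (+-cancelʳ-≤ (k * binom m k) _ _ (begin
  suc k * (Y * binom m k) + k * binom m k ≡⟨ arith Y k (binom m k) ⟩
  (Y * suc k + k) * binom m k             ≤⟨ *-monoˡ-≤ (binom m k) le ⟩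
  m * binom m k                           ≡⟨ sym (binom-absorb m k) ⟩
  suc k * binom m (suc k) + k * binom m k ∎))
  where
  open ≤-Reasoning
  arith : ∀ Y k b → suc k * (Y * b) + k * b ≡ (Y * suc k + k) * b
  arith = solve-∀

binom-pos : ∀ {m k} → k ≤ m → 1 ≤ binom m k
binom-pos z≤n                 = ≤-refl
binom-pos {suc m} {suc k} (s≤s le) = ≤-trans (binom-pos le) (m≤n+m _ (binom m (suc k)))

-- Uniform families and stars

sized : ∀ {n} → ℕ → Family n
sized k A = ∣ A ∣ ≡ᵇ k

sized⇒≡ : ∀ {n} k (A : Subset n) → sized k A ≡ true → ∣ A ∣ ≡ k
sized⇒≡ k A eq = ≡ᵇ⇒≡ ∣ A ∣ k (subst T (sym eq) _)

≡⇒sized : ∀ {n} k (A : Subset n) → ∣ A ∣ ≡ k → sized k A ≡ true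
≡⇒sized .(∣ A ∣) A refl = lem ∣ A ∣
  where
  lem : ∀ a → (a ≡ᵇ a) ≡ true
  lem zero    = refl
  lem (suc a) = lem a

-- Both sides split by the first coordinate: `binom` follows Pascal's rule in the order in which
-- `Sum` adds its halves.
card-sized : ∀ n k → card {n} (sized k) ≡ binom n k
card-sized zero    zero    = refl
card-sized zero    (suc k) = refl
card-sized (suc n) zero    = trans (cong₂ _+_ (card-sized n zero) (card-false {n} (λ _ → refl))) refl
card-sized (suc n) (suc k) = cong₂ _+_ (card-sized n (suc k)) (card-sized n k)

meets : ∀ {n} → Subset n → Subset n → Bool
meets []       []       = false
meets (a ∷ A) (b ∷ B) = (a ∧ b) ∨ meets A B

star : ∀ {n} → ℕ → Subset n → Family n
star k U A = sized k A ∧ meets A U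

¬false⇒true : ∀ {a} → ¬ (a ≡ false) → a ≡ true
¬false⇒true {true}  _ = refl
¬false⇒true {false} h = ⊥-elim (h refl)

∧-true : ∀ {a b} → (a ∧ b) ≡ true → a ≡ true × b ≡ true
∧-true {true} {true} _ = refl , refl

∧-intro : ∀ {a b} → a ≡ true → b ≡ true → (a ∧ b) ≡ true
∧-intro refl refl = refl

∨-false : ∀ {a b} → (a ∨ b) ≡ false → a ≡ false × b ≡ false
∨-false {false} {false} _ = refl , refl

true≢false : ∀ {a} {P : Set} → a ≡ true → a ≡ false → P
true≢false refl ()

¬true⇒false : ∀ {a} → ¬ (a ≡ true) → a ≡ false
¬true⇒false {false} _ = refl
¬true⇒false {true}  h = ⊥-elim (h refl)

disjoint-count : ∀ {n} k (U : Subset n) r → r + ∣ U ∣ ≡ n →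
  card (λ A → sized k A ∧ not (meets A U)) ≡ binom r k
disjoint-count {zero} zero    [] zero refl = refl
disjoint-count {zero} (suc k) [] zero refl = refl
disjoint-count {suc n} k (true ∷ U) r eq =
  trans (cong₂ _+_ (disjoint-count k U r (suc-injective (trans (sym (+-suc r ∣ U ∣)) eq)))
                   (card-false {n} (λ A → ∧-zeroʳ _)))
        (+-identityʳ _)
disjoint-count {suc n} k (false ∷ U) zero eq = ⊥-elim (1+n≰n (subst (_≤ n) eq (∣p∣≤n U)))
disjoint-count {suc n} zero (false ∷ U) (suc r) eq =
  trans (cong₂ _+_ (disjoint-count zero U r (suc-injective eq)) (card-false {n} (λ _ → refl))) refl
disjoint-count {suc n} (suc k) (false ∷ U) (suc r) eq =
  cong₂ _+_ (disjoint-count (suc k) U r (suc-injective eq)) (disjoint-count k U r (suc-injective eq))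

card-star : ∀ {n} k (U : Subset n) r → r + ∣ U ∣ ≡ n → card (star k U) + binom r k ≡ binom n k
card-star {n} k U r eq = trans (cong (card (star k U) +_) (sym (disjoint-count k U r eq)))
  (trans (sym (card-split (sized k) (λ A → meets A U))) (card-sized n k))

-- Counting k-sets whose walk goes below 0

-- Reading A as a walk whose height grows by 1 at each non-element and drops by c at each element,
-- bad c a A says that the walk started at height a goes below 0. For a walk that never does,
-- the j-th element of A is at least (c + 1) j - a.
bad : ∀ {n} → ℕ → ℕ → Family n
bad c a []          = false
bad c a (false ∷ A) = bad c (suc a) A
bad c a (true ∷ A) with c ≤? a
... | yes _ = bad c (a ∸ c) A
... | no  _ = true

-- Each element costs `c`, so this starting height pays for all of them in advance.
bad-high : ∀ {n} c a (A : Subset n) → c * ∣ A ∣ ≤ a → bad c a A ≡ false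
bad-high c a []          le = refl
bad-high c a (false ∷ A) le = bad-high c (suc a) A (m≤n⇒m≤1+n le)
bad-high c a (true ∷ A)  le with c ≤? a
... | yes _  = bad-high c (a ∸ c) A (m+n≤o⇒m≤o∸n (c * ∣ A ∣) (subst (_≤ a) (trans (*-suc c ∣ A ∣) (+-comm c _)) le))
... | no c≰a = ⊥-elim (c≰a (≤-trans (subst (c ≤_) (sym (*-suc c ∣ A ∣)) (m≤m+n c _)) le))

badCount : (m c k a : ℕ) → ℕ
badCount m c k a = card {m} (λ A → sized k A ∧ bad c a A)

sized-bad-high : ∀ {n} c a k → c * k ≤ a → (A : Subset n) → (sized k A ∧ bad c a A) ≡ false
sized-bad-high c a k le A with sized k A in eq
... | false = refl
... | true  = bad-high c a A (subst (λ j → c * j ≤ a) (sym (sized⇒≡ k A eq)) le)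

-- X ^ (- height) is a supermartingale along the walk of a random k-set as long as the density
-- k / m is at most X ^ (- c) / 2, and once the height reaches c k the walk cannot go below 0.
badCount-bound : ∀ c X → 2 ≤ X → ∀ m k a → (2 * X ^ c + 1 + c) * k ≤ m + a →
  X ^ a * badCount m c k a ≤ binom m k
badCount-bound c X 2≤X zero k a le =
  ≤-trans (≤-reflexive (trans (cong (X ^ a *_) (lem k)) (*-zeroʳ (X ^ a)))) z≤n
  where
  lem : ∀ k → badCount zero c k a ≡ 0
  lem zero    = refl
  lem (suc k) = refl
badCount-bound c X 2≤X (suc m) zero a le =
  ≤-trans (≤-reflexive (trans (cong (X ^ a *_) (card-false {suc m} (sized-bad-high c a zero (subst (_≤ a) (sym (*-zeroʳ c)) z≤n))))
                                (*-zeroʳ (X ^ a)))) z≤n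
badCount-bound c X 2≤X (suc m) (suc k) a le with c * suc k ≤? a
... | yes ck≤a =
  ≤-trans (≤-reflexive (trans (cong (X ^ a *_) (card-false {suc m} (sized-bad-high c a (suc k) ck≤a)))
                                (*-zeroʳ (X ^ a)))) z≤n
-- Each branch gets half of the bound. Skipping a coordinate raises the height, which saves a factor
-- `X ≥ 2`; taking one loses `X ^ c`, but `binom m k` is smaller than `binom m (suc k)` by a factor
-- of at least `2 * X ^ c`.
... | no ck≰a = *-cancelˡ-≤ 2 (begin
    2 * (X ^ a * (N₀ + N₁))             ≡⟨ arith (X ^ a) N₀ N₁ ⟩
    2 * (X ^ a * N₀) + 2 * (X ^ a * N₁) ≤⟨ +-mono-≤ notTaken (*-monoʳ-≤ 2 taken) ⟩
    binom m (suc k) + 2 * (X ^ c * binom m k) ≡⟨ cong (binom m (suc k) +_) (sym (*-assoc 2 (X ^ c) _)) ⟩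
    binom m (suc k) + 2 * X ^ c * binom m k ≤⟨ +-monoʳ-≤ (binom m (suc k)) (binom-ratio (2 * X ^ c) m k room) ⟩
    binom m (suc k) + binom m (suc k)   ≤⟨ +-mono-≤ grow grow ⟩
    binom (suc m) (suc k) + binom (suc m) (suc k) ≡⟨ cong (binom (suc m) (suc k) +_) (sym (+-identityʳ _)) ⟩
    2 * binom (suc m) (suc k)           ∎)
  where
  open ≤-Reasoning
  N₀ N₁ : ℕ
  N₀ = badCount m c (suc k) (suc a)
  N₁ = card {m} (λ A → sized k A ∧ bad c a (true ∷ A))

  grow : binom m (suc k) ≤ binom (suc m) (suc k)
  grow = m≤m+n (binom m (suc k)) (binom m k)

  arith : ∀ x p q → 2 * (x * (p + q)) ≡ 2 * (x * p) + 2 * (x * q)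
  arith = solve-∀

  -- Only heights below `c * suc k` remain, so the summand `c * suc k` of the hypothesis absorbs
  -- `a`.
  room : 2 * X ^ c * suc k + k ≤ m
  room = ≤-pred (+-cancelʳ-≤ (c * suc k) _ _ (begin
    suc (2 * X ^ c * suc k + k) + c * suc k ≡⟨ lem (2 * X ^ c) k c ⟩
    (2 * X ^ c + 1 + c) * suc k ≤⟨ le ⟩
    suc m + a ≤⟨ +-monoʳ-≤ (suc m) (<⇒≤ (≰⇒> ck≰a)) ⟩
    suc m + c * suc k ∎))
    where
    lem : ∀ y k c → suc (y * suc k + k) + c * suc k ≡ (y + 1 + c) * suc k
    lem = solve-∀

  notTaken : 2 * (X ^ a * N₀) ≤ binom m (suc k)
  notTaken = begin
    2 * (X ^ a * N₀) ≤⟨ *-monoˡ-≤ (X ^ a * N₀) 2≤X ⟩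
    X * (X ^ a * N₀) ≡⟨ sym (*-assoc X (X ^ a) N₀) ⟩
    X ^ suc a * N₀   ≤⟨ badCount-bound c X 2≤X m (suc k) (suc a) (subst ((2 * X ^ c + 1 + c) * suc k ≤_) (sym (+-suc m a)) le) ⟩
    binom m (suc k)  ∎

  instance
    X≢0 : NonZero X
    X≢0 = >-nonZero (≤-trans (s≤s z≤n) 2≤X)

  taken : X ^ a * N₁ ≤ X ^ c * binom m k
  taken with c ≤? a
  ... | yes c≤a = begin
    X ^ a * N           ≡⟨ cong (λ e → X ^ e * N) (sym (m+[n∸m]≡n c≤a)) ⟩
    X ^ (c + (a ∸ c)) * N ≡⟨ cong (_* N) (^-distribˡ-+-* X c (a ∸ c)) ⟩
    X ^ c * X ^ (a ∸ c) * N ≡⟨ *-assoc (X ^ c) _ _ ⟩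
    X ^ c * (X ^ (a ∸ c) * N) ≤⟨ *-monoʳ-≤ (X ^ c) (badCount-bound c X 2≤X m k (a ∸ c) inv) ⟩
    X ^ c * binom m k   ∎
    where
    N : ℕ
    N = badCount m c k (a ∸ c)
    lem : ∀ y k c → (y + 1 + c) * k + suc c + y ≡ (y + 1 + c) * suc k
    lem = solve-∀
    inv : (2 * X ^ c + 1 + c) * k ≤ m + (a ∸ c)
    inv = +-cancelʳ-≤ (suc c) _ _ (begin
      (2 * X ^ c + 1 + c) * k + suc c ≤⟨ m≤m+n _ (2 * X ^ c) ⟩
      (2 * X ^ c + 1 + c) * k + suc c + 2 * X ^ c ≡⟨ lem (2 * X ^ c) k c ⟩
      (2 * X ^ c + 1 + c) * suc k ≤⟨ le ⟩
      suc m + a ≡⟨ cong (suc m +_) (sym (m∸n+n≡m c≤a)) ⟩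
      suc m + (a ∸ c + c) ≡⟨ lem₂ m (a ∸ c) c ⟩
      m + (a ∸ c) + suc c ∎)
      where
      lem₂ : ∀ m x c → suc m + (x + c) ≡ m + x + suc c
      lem₂ = solve-∀
  ... | no c≰a = *-mono-≤ (^-monoʳ-≤ X (<⇒≤ (≰⇒> c≰a)))
    (≤-trans (card-mono {m} (λ A → proj₁ ∘ ∧-true)) (≤-reflexive (card-sized m k)))

-- A sufficient condition for being dominated by a thread, simple enough to count: the walk starts
-- only after `s` coordinates, which must all be skipped.
delayed : ∀ {n} → ℕ → ℕ → ℕ → Family n
delayed c zero    b A       = not (bad c b A)
delayed c (suc s) b []      = true
delayed c (suc s) b (x ∷ A) = not x ∧ delayed c s b A

-- Pascal's rule, where below the middle the second term is at most the first.
binom-double : ∀ m k → 2 * k ≤ suc m → binom (suc m) k ≤ 2 * binom m k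
binom-double m zero    le = s≤s z≤n
binom-double m (suc k) le = begin
  binom m (suc k) + binom m k       ≤⟨ +-monoʳ-≤ (binom m (suc k)) (subst (_≤ binom m (suc k)) (*-identityˡ (binom m k)) (binom-ratio 1 m k (≤-pred (subst (_≤ suc m) (lem k) le)))) ⟩
  binom m (suc k) + binom m (suc k) ≡⟨ cong (binom m (suc k) +_) (sym (+-identityʳ _)) ⟩
  2 * binom m (suc k)               ∎
  where
  open ≤-Reasoning
  lem : ∀ k → 2 * suc k ≡ suc (1 * suc k + k)
  lem = solve-∀

-- Every skipped coordinate costs a factor 2 by `binom-double`. After the delay one more suffices:
-- from height 1 at most the proportion `1 / X ≤ 1 / 2` of the walks is bad.
delayed-count : ∀ c X → 2 ≤ X → ∀ m s k → s + (2 * X ^ c + 1 + c) * k ≤ m →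
  binom m k ≤ 2 ^ suc s * card {m} (λ A → sized k A ∧ delayed c s 1 A)
delayed-count c X 2≤X m zero k le = *-cancelˡ-≤ 1 (+-cancelʳ-≤ (binom m k) _ _ (begin
    1 * binom m k + binom m k       ≡⟨ arith (binom m k) ⟩
    2 * binom m k                   ≡⟨ cong (2 *_) (trans (sym (card-sized m k)) (card-split {m} (sized k) (bad c 1))) ⟩
    2 * (N + G)                     ≡⟨ arith₂ N G ⟩
    1 * (2 * G) + 2 * N             ≤⟨ +-monoʳ-≤ (1 * (2 * G)) small ⟩
    1 * (2 * G) + binom m k         ∎))
  where
  open ≤-Reasoning
  N G : ℕ
  N = badCount m c k 1
  G = card {m} (λ A → sized k A ∧ delayed c zero 1 A)
  arith : ∀ x → 1 * x + x ≡ 2 * x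
  arith = solve-∀
  arith₂ : ∀ N G → 2 * (N + G) ≡ 1 * (2 * G) + 2 * N
  arith₂ = solve-∀
  small : 2 * N ≤ binom m k
  small = begin
    2 * N     ≤⟨ *-monoˡ-≤ N 2≤X ⟩
    X * N     ≡⟨ cong (_* N) (sym (*-identityʳ X)) ⟩
    X ^ 1 * N ≤⟨ badCount-bound c X 2≤X m k 1 (≤-trans le (m≤m+n m 1)) ⟩
    binom m k ∎
delayed-count c X 2≤X (suc m) (suc s) k (s≤s le) = begin
  binom (suc m) k ≤⟨ binom-double m k (begin
      2 * k ≤⟨ *-monoˡ-≤ k (≤-trans (*-monoʳ-≤ 2 (m^n>0 X c)) (≤-trans (m≤m+n (2 * X ^ c) 1) (m≤m+n _ c))) ⟩
      (2 * X ^ c + 1 + c) * k ≤⟨ m≤n+m _ s ⟩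
      s + (2 * X ^ c + 1 + c) * k ≤⟨ le ⟩
      m ≤⟨ n≤1+n m ⟩
      suc m ∎) ⟩
  2 * binom m k ≤⟨ *-monoʳ-≤ 2 (delayed-count c X 2≤X m s k le) ⟩
  2 * (2 ^ suc s * card {m} (λ A → sized k A ∧ delayed c s 1 A)) ≡⟨ sym (*-assoc 2 (2 ^ suc s) _) ⟩
  2 ^ suc (suc s) * card {m} (λ A → sized k A ∧ delayed c s 1 A) ≤⟨ *-monoʳ-≤ (2 ^ suc (suc s)) (m≤m+n _ _) ⟩
  2 ^ suc (suc s) * card {suc m} (λ A → sized k A ∧ delayed c (suc s) 1 A) ∎
  where
  open ≤-Reasoning
  instance
    X≢0 : NonZero X
    X≢0 = >-nonZero (≤-trans (s≤s z≤n) 2≤X)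

-- Shifting

-- Positions out of range are allowed in swapAt, shiftAt and ClosedAt and then change nothing.
swapAt : ∀ {n} → ℕ → Subset n → Subset n
swapAt zero    []          = []
swapAt zero    (a ∷ [])    = a ∷ []
swapAt zero    (a ∷ b ∷ A) = b ∷ a ∷ A
swapAt (suc p) []          = []
swapAt (suc p) (a ∷ A)     = a ∷ swapAt p A

-- The compression that moves an element from `p + 1` to `p`, given as a membership table: of two
-- sets exchanged by the swap, the left one belongs if either did, the right one only if both did.
-- Shifts of neighbours are enough, since they generate domination.
shiftAt : ∀ {n} → ℕ → Family n → Family n
shiftAt zero    F []                   = F []
shiftAt zero    F (a ∷ [])             = F (a ∷ [])
shiftAt zero    F (false ∷ false ∷ A)  = F (false ∷ false ∷ A)
shiftAt zero    F (false ∷ true ∷ A)   = F (false ∷ true ∷ A) ∧ F (true ∷ false ∷ A)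
shiftAt zero    F (true ∷ false ∷ A)   = F (true ∷ false ∷ A) ∨ F (false ∷ true ∷ A)
shiftAt zero    F (true ∷ true ∷ A)    = F (true ∷ true ∷ A)
shiftAt (suc p) F []                   = F []
shiftAt (suc p) F (a ∷ A)              = shiftAt p (F ∘ (a ∷_)) A

-- The only access to the shift when it is undone: every pair of swapped sets is either left alone
-- or exchanged.
shift-dichotomy : ∀ {n} p (F : Family n) A →
  (shiftAt p F A ≡ F A × shiftAt p F (swapAt p A) ≡ F (swapAt p A)) ⊎
  (shiftAt p F A ≡ F (swapAt p A) × shiftAt p F (swapAt p A) ≡ F A)
shift-dichotomy zero F []                  = inj₁ (refl , refl)
shift-dichotomy zero F (a ∷ [])            = inj₁ (refl , refl)
shift-dichotomy zero F (false ∷ false ∷ A) = inj₁ (refl , refl)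
shift-dichotomy zero F (true ∷ true ∷ A)   = inj₁ (refl , refl)
shift-dichotomy zero F (false ∷ true ∷ A) with F (false ∷ true ∷ A) | F (true ∷ false ∷ A)
... | false | false = inj₁ (refl , refl)
... | false | true  = inj₁ (refl , refl)
... | true  | false = inj₂ (refl , refl)
... | true  | true  = inj₁ (refl , refl)
shift-dichotomy zero F (true ∷ false ∷ A) with F (false ∷ true ∷ A) | F (true ∷ false ∷ A)
... | false | false = inj₁ (refl , refl)
... | false | true  = inj₁ (refl , refl)
... | true  | false = inj₂ (refl , refl)
... | true  | true  = inj₁ (refl , refl)
shift-dichotomy (suc p) F []      = inj₁ (refl , refl)
shift-dichotomy (suc p) F (a ∷ A) = shift-dichotomy p (F ∘ (a ∷_)) A

swap-involutive : ∀ {n} p (A : Subset n) → swapAt p (swapAt p A) ≡ A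
swap-involutive zero    []          = refl
swap-involutive zero    (a ∷ [])    = refl
swap-involutive zero    (a ∷ b ∷ A) = refl
swap-involutive (suc p) []          = refl
swap-involutive (suc p) (a ∷ A)     = cong (a ∷_) (swap-involutive p A)

∣∷∣ : ∀ {n} a (A : Subset n) → ∣ a ∷ A ∣ ≡ bit a + ∣ A ∣
∣∷∣ false A = refl
∣∷∣ true  A = refl

∣swap∣ : ∀ {n} p (A : Subset n) → ∣ swapAt p A ∣ ≡ ∣ A ∣
∣swap∣ zero    []                  = refl
∣swap∣ zero    (a ∷ [])            = refl
∣swap∣ zero    (false ∷ false ∷ A) = refl
∣swap∣ zero    (false ∷ true ∷ A)  = refl
∣swap∣ zero    (true ∷ false ∷ A)  = refl
∣swap∣ zero    (true ∷ true ∷ A)   = refl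
∣swap∣ (suc p) []                  = refl
∣swap∣ (suc p) (a ∷ A)             = trans (∣∷∣ a (swapAt p A)) (trans (cong (bit a +_) (∣swap∣ p A)) (sym (∣∷∣ a A)))

meets-swap : ∀ {n} p (A B : Subset n) → meets (swapAt p A) (swapAt p B) ≡ meets A B
meets-swap zero    []          []          = refl
meets-swap zero    (a ∷ [])    (b ∷ [])    = refl
meets-swap zero    (a ∷ a′ ∷ A) (b ∷ b′ ∷ B) with a ∧ b | a′ ∧ b′
... | false | false = refl
... | false | true  = refl
... | true  | false = refl
... | true  | true  = refl
meets-swap (suc p) []          []          = refl
meets-swap (suc p) (a ∷ A)     (b ∷ B)     = cong ((a ∧ b) ∨_) (meets-swap p A B)

meets-sym : ∀ {n} (A B : Subset n) → meets A B ≡ meets B A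
meets-sym []      []      = refl
meets-sym (false ∷ A) (false ∷ B) = meets-sym A B
meets-sym (false ∷ A) (true ∷ B)  = meets-sym A B
meets-sym (true ∷ A)  (false ∷ B) = meets-sym A B
meets-sym (true ∷ A)  (true ∷ B)  = refl

bitAt : ∀ {n} → ℕ → Subset n → Bool
bitAt p       []      = false
bitAt zero    (a ∷ A) = a
bitAt (suc p) (a ∷ A) = bitAt p A

disjoint⇒bitAt : ∀ {n} p (A B : Subset n) → meets A B ≡ false → bitAt p A ≡ true → bitAt p B ≡ false
disjoint⇒bitAt zero    (true ∷ A) (false ∷ B) _  _  = refl
disjoint⇒bitAt (suc p) (a ∷ A)    (b ∷ B)     dj pA = disjoint⇒bitAt p A B (proj₂ (∨-false dj)) pA

shift-true : ∀ {n} p (F : Family n) A → shiftAt p F A ≡ true →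
  F A ≡ true ⊎ (bitAt p A ≡ true × F (swapAt p A) ≡ true)
shift-true zero F []                  h = inj₁ h
shift-true zero F (a ∷ [])            h = inj₁ h
shift-true zero F (false ∷ false ∷ A) h = inj₁ h
shift-true zero F (false ∷ true ∷ A)  h = inj₁ (proj₁ (∧-true h))
shift-true zero F (true ∷ false ∷ A)  h with F (true ∷ false ∷ A)
... | true  = inj₁ refl
... | false = inj₂ (refl , h)
shift-true zero F (true ∷ true ∷ A)   h = inj₁ h
shift-true (suc p) F []               h = inj₁ h
shift-true (suc p) F (a ∷ A)          h = shift-true p (F ∘ (a ∷_)) A h

-- A set that could have been moved left stays only because its image was already present; any other
-- set without `p` is its own swap.
shift-true-outside : ∀ {n} p (F : Family n) A → shiftAt p F A ≡ true → bitAt p A ≡ false → F (swapAt p A) ≡ true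
shift-true-outside zero F []                  h _ = h
shift-true-outside zero F (a ∷ [])            h _ = h
shift-true-outside zero F (false ∷ false ∷ A) h _ = h
shift-true-outside zero F (false ∷ true ∷ A)  h _ = proj₂ (∧-true h)
shift-true-outside (suc p) F []               h _ = h
shift-true-outside (suc p) F (a ∷ A)          h o = shift-true-outside p (F ∘ (a ∷_)) A h o

card-shift : ∀ {n} p (F : Family n) → card (shiftAt p F) ≡ card F
card-shift {zero}        zero    F = refl
card-shift {suc zero}    zero    F = refl
card-shift {suc (suc n)} zero    F =
  trans (+-assoc S₀₀ _ _) (trans (cong (S₀₀ +_) (trans (sym (+-assoc (Sum n _) (Sum n _) S₁₁))
   (trans (cong (_+ S₁₁) middle) (+-assoc S₀₁ S₁₀ S₁₁)))) (sym (+-assoc S₀₀ S₀₁ (S₁₀ + S₁₁))))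
  where
  S₀₀ S₀₁ S₁₀ S₁₁ : ℕ
  S₀₀ = card (λ A → F (false ∷ false ∷ A))
  S₀₁ = card (λ A → F (false ∷ true ∷ A))
  S₁₀ = card (λ A → F (true ∷ false ∷ A))
  S₁₁ = card (λ A → F (true ∷ true ∷ A))
  lem : ∀ a b → bit (a ∧ b) + bit (b ∨ a) ≡ bit a + bit b
  lem false false = refl
  lem false true  = refl
  lem true  false = refl
  lem true  true  = refl
  middle : card (λ A → shiftAt zero F (false ∷ true ∷ A)) + card (λ A → shiftAt zero F (true ∷ false ∷ A)) ≡ S₀₁ + S₁₀
  middle = trans (sym (Sum-+ n _ _)) (trans (Sum-cong n (λ A → lem (F (false ∷ true ∷ A)) (F (true ∷ false ∷ A)))) (Sum-+ n _ _))
card-shift {zero}  (suc p) F = refl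
card-shift {suc n} (suc p) F = cong₂ _+_ (card-shift p (F ∘ (false ∷_))) (card-shift p (F ∘ (true ∷_)))

-- e plus the sum of the elements of A, when the coordinates are numbered from d on.
positions : ∀ {n} → ℕ → ℕ → Subset n → ℕ
positions e d []          = e
positions e d (false ∷ A) = positions e (suc d) A
positions e d (true ∷ A)  = positions (d + e) (suc d) A

positions-suc : ∀ {n} e d (A : Subset n) → positions (suc e) d A ≡ suc (positions e d A)
positions-suc e d []          = refl
positions-suc e d (false ∷ A) = positions-suc e (suc d) A
positions-suc e d (true ∷ A)  = trans (cong (λ x → positions x (suc d) A) (+-suc d e)) (positions-suc (d + e) (suc d) A)

-- The potential that makes repeated shifting stop.
weight : ∀ {n} → ℕ → ℕ → Family n → ℕ
weight {n} e d F = Sum n (λ A → bit (F A) * positions e d A)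

ClosedAt : ∀ {n} → ℕ → Family n → Set
ClosedAt {zero}        p       F = Unit
ClosedAt {suc n}       (suc p) F = ∀ a → ClosedAt p (F ∘ (a ∷_))
ClosedAt {suc zero}    zero    F = Unit
ClosedAt {suc (suc n)} zero    F = ∀ A → F (false ∷ true ∷ A) ≡ true → F (true ∷ false ∷ A) ≡ true

closedAt-≥ : ∀ {n} p (F : Family n) → n ≤ p → ClosedAt p F
closedAt-≥ {zero}        p       F le       = tt
closedAt-≥ {suc zero}    (suc p) F (s≤s le) = λ a → tt
closedAt-≥ {suc (suc n)} (suc p) F (s≤s le) = λ a → closedAt-≥ p (F ∘ (a ∷_)) le

module _ {n : ℕ} (e d : ℕ) (F : Family (suc (suc n))) where
  private
    a b : Subset n → Bool
    a A = F (false ∷ true ∷ A)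
    b A = F (true ∷ false ∷ A)
    u v : Subset n → ℕ
    u = positions (suc d + e) (suc (suc d))
    v = positions (d + e) (suc (suc d))
    w₀₀ w₁₁ : ℕ
    w₀₀ = weight e (suc (suc d)) (λ A → F (false ∷ false ∷ A))
    w₁₁ = weight (suc d + (d + e)) (suc (suc d)) (λ A → F (true ∷ true ∷ A))

    mid mid′ : Subset n → ℕ
    mid  A = bit (a A) * u A + bit (b A) * v A
    mid′ A = bit (a A ∧ b A) * u A + bit (b A ∨ a A) * v A

    regroup : ∀ (g h : Subset n → ℕ) → w₀₀ + Sum n g + (Sum n h + w₁₁) ≡ Sum n (λ A → g A + h A) + (w₀₀ + w₁₁)
    regroup g h = trans (arith w₀₀ (Sum n g) (Sum n h) w₁₁) (cong (_+ (w₀₀ + w₁₁)) (sym (Sum-+ n g h)))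
      where
      arith : ∀ w x y z → w + x + (y + z) ≡ x + y + (w + z)
      arith = solve-∀

    weight-eq : weight e d F ≡ Sum n mid + (w₀₀ + w₁₁)
    weight-eq = regroup _ _

    weight-eq′ : weight e d (shiftAt zero F) ≡ Sum n mid′ + (w₀₀ + w₁₁)
    weight-eq′ = regroup _ _

    u≡ : ∀ A → u A ≡ suc (v A)
    u≡ = positions-suc (d + e) (suc (suc d))

    lem : ∀ a b u v → u ≡ suc v → bit (a ∧ b) * u + bit (b ∨ a) * v ≤ bit a * u + bit b * v
    lem false false u v eq   = ≤-refl
    lem false true  u v eq   = ≤-refl
    lem true  false u v refl = ≤-trans (n≤1+n _) (≤-reflexive (sym (+-identityʳ _)))
    lem true  true  u v eq   = ≤-refl

    lem⁻¹ : ∀ a b u v → u ≡ suc v → bit a * u + bit b * v ≤ bit (a ∧ b) * u + bit (b ∨ a) * v → a ≡ true → b ≡ true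
    lem⁻¹ true false u v refl le _ = ⊥-elim (1+n≰n (≤-trans (≤-reflexive (sym (+-identityʳ _))) le))
    lem⁻¹ true true  u v eq   le _ = refl

    mid′≤mid : ∀ A → mid′ A ≤ mid A
    mid′≤mid A = lem (a A) (b A) (u A) (v A) (u≡ A)

  weight-shift-zero : weight e d (shiftAt zero F) ≤ weight e d F
  weight-shift-zero = subst₂ _≤_ (sym weight-eq′) (sym weight-eq) (+-monoˡ-≤ (w₀₀ + w₁₁) (Sum-mono n mid′≤mid))

  weight-closed-zero : weight e d F ≤ weight e d (shiftAt zero F) → ClosedAt zero F
  weight-closed-zero le A = lem⁻¹ (a A) (b A) (u A) (v A) (u≡ A)
    (Sum-squeeze n mid′≤mid (+-cancelʳ-≤ (w₀₀ + w₁₁) _ _ (subst₂ _≤_ weight-eq weight-eq′ le)) A)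

weight-shift : ∀ {n} e d p (F : Family n) → weight e d (shiftAt p F) ≤ weight e d F
weight-shift {zero}        e d zero    F = ≤-refl
weight-shift {suc zero}    e d zero    F = ≤-refl
weight-shift {suc (suc n)} e d zero    F = weight-shift-zero e d F
weight-shift {zero}        e d (suc p) F = ≤-refl
weight-shift {suc n}       e d (suc p) F =
  +-mono-≤ (weight-shift e (suc d) p (F ∘ (false ∷_))) (weight-shift (d + e) (suc d) p (F ∘ (true ∷_)))

-- A moved set lowers the weight by one and nothing raises it, so a weight that does not drop means
-- that no set was moved.
weight-closed : ∀ {n} e d p (F : Family n) → weight e d F ≤ weight e d (shiftAt p F) → ClosedAt p F
weight-closed {zero}        e d p       F le = tt
weight-closed {suc zero}    e d zero    F le = tt
weight-closed {suc (suc n)} e d zero    F le = weight-closed-zero e d F le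
weight-closed {suc n}       e d (suc p) F le false = weight-closed e (suc d) p (F ∘ (false ∷_))
  (+-cancelʳ-≤ _ _ _ (≤-trans le (+-monoʳ-≤ (weight e (suc d) (shiftAt p (F ∘ (false ∷_)))) (weight-shift (d + e) (suc d) p (F ∘ (true ∷_))))))
weight-closed {suc n}       e d (suc p) F le true  = weight-closed (d + e) (suc d) p (F ∘ (true ∷_))
  (+-cancelˡ-≤ _ _ _ (≤-trans le (+-monoˡ-≤ (weight (d + e) (suc d) (shiftAt p (F ∘ (true ∷_)))) (weight-shift e (suc d) p (F ∘ (false ∷_))))))

Closed : ∀ {n} → Family n → Set
Closed F = ∀ p → ClosedAt p F

-- Every prefix of B has at least as many elements as that of A, B having a lead of d at the start.
Dom : ∀ {n} → ℕ → Subset n → Subset n → Set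
Dom d       []          []          = Unit
Dom d       (false ∷ B) (false ∷ A) = Dom d B A
Dom d       (true ∷ B)  (true ∷ A)  = Dom d B A
Dom d       (true ∷ B)  (false ∷ A) = Dom (suc d) B A
Dom zero    (false ∷ B) (true ∷ A)  = Absurd
Dom (suc d) (false ∷ B) (true ∷ A)  = Dom d B A

dropFirst : ∀ {n} → Subset n → Subset n
dropFirst []          = []
dropFirst (true ∷ A)  = false ∷ A
dropFirst (false ∷ A) = false ∷ dropFirst A

∣dropFirst∣ : ∀ {n} (A : Subset n) h → ∣ A ∣ ≡ suc h → ∣ dropFirst A ∣ ≡ h
∣dropFirst∣ (true ∷ A)  h eq = suc-injective eq
∣dropFirst∣ (false ∷ A) h eq = ∣dropFirst∣ A h eq

-- Up to its first element `A` has drawn nothing from the lead; giving up that element repays one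
-- unit of it.
Dom-dropFirst : ∀ {n} d (B A : Subset n) → Dom (suc d) B A → Dom d B (dropFirst A)
Dom-dropFirst d []          []          dom = tt
Dom-dropFirst d (false ∷ B) (false ∷ A) dom = Dom-dropFirst d B A dom
Dom-dropFirst d (true ∷ B)  (false ∷ A) dom = Dom-dropFirst (suc d) B A dom
Dom-dropFirst d (false ∷ B) (true ∷ A)  dom = dom
Dom-dropFirst d (true ∷ B)  (true ∷ A)  dom = dom

-- The first element of `A` travels to the front by neighbouring shifts, one place at a time.
bubble : ∀ {n} {F : Family (suc n)} → Closed F → ∀ A h → ∣ A ∣ ≡ suc h →
  F (false ∷ A) ≡ true → F (true ∷ dropFirst A) ≡ true
bubble cl (true ∷ A)  h eq FA = cl zero A FA
bubble cl (false ∷ A) h eq FA = cl zero (dropFirst A) (bubble (λ p → cl (suc p) false) A h eq FA)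

-- Coordinate by coordinate. Where `B` has an element and `A` has none, the first element of `A` is
-- brought there by `bubble`; the opposite case is excluded by the lead 0.
Closed⇒Dom-closed : ∀ {n} {F : Family n} → Closed F → ∀ B A → Dom 0 B A → ∣ A ∣ ≡ ∣ B ∣ → F A ≡ true → F B ≡ true
Closed⇒Dom-closed cl []          []          dom eq FA = FA
Closed⇒Dom-closed cl (false ∷ B) (false ∷ A) dom eq FA = Closed⇒Dom-closed (λ p → cl (suc p) false) B A dom eq FA
Closed⇒Dom-closed cl (true ∷ B)  (true ∷ A)  dom eq FA = Closed⇒Dom-closed (λ p → cl (suc p) true) B A dom (suc-injective eq) FA
Closed⇒Dom-closed cl (true ∷ B)  (false ∷ A) dom eq FA =
  Closed⇒Dom-closed (λ p → cl (suc p) true) B (dropFirst A) (Dom-dropFirst 0 B A dom)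
    (∣dropFirst∣ A ∣ B ∣ eq) (bubble cl A ∣ B ∣ eq FA)

-- Greedy sets

-- The walk that takes an element whenever its height permits, up to `h` of them. This makes it the
-- dominating set among those whose walk survives from the same height.
greedy : (c a h m : ℕ) → Subset m
greedy c a h       zero    = []
greedy c a zero    (suc m) = false ∷ greedy c a zero m
greedy c a (suc h) (suc m) with c ≤? a
... | yes _ = true  ∷ greedy c (a ∸ c) h m
... | no  _ = false ∷ greedy c (suc a) (suc h) m

-- Height plus remaining coordinates is unchanged by a skip and falls by `c + 1` at an element. The
-- condition `h ≤ m` is separate because a large initial height supplies no coordinates.
∣greedy∣ : ∀ c a h m → h ≤ m → suc c * h ≤ a + m → ∣ greedy c a h m ∣ ≡ h
∣greedy∣ c a zero    zero    _   _  = refl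
∣greedy∣ c a zero    (suc m) h≤m le = ∣greedy∣ c a zero m z≤n (≤-trans (≤-reflexive (*-zeroʳ (suc c))) z≤n)
∣greedy∣ c a (suc h) (suc m) (s≤s h≤m) le with c ≤? a
... | yes c≤a = cong suc (∣greedy∣ c (a ∸ c) h m h≤m (+-cancelˡ-≤ (suc c) _ _ (begin
    suc c + suc c * h       ≡⟨ sym (*-suc (suc c) h) ⟩
    suc c * suc h           ≤⟨ le ⟩
    a + suc m               ≡⟨ cong (_+ suc m) (sym (m+[n∸m]≡n c≤a)) ⟩
    c + (a ∸ c) + suc m     ≡⟨ arith c (a ∸ c) m ⟩
    suc c + (a ∸ c + m)     ∎)))
  where
  open ≤-Reasoning
  arith : ∀ c x m → c + x + suc m ≡ suc c + (x + m)
  arith = solve-∀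
... | no c≰a = ∣greedy∣ c (suc a) (suc h) m (+-cancelˡ-≤ c _ _ (begin
    c + suc h         ≤⟨ +-monoʳ-≤ c (s≤s (m≤m+n h (c * h))) ⟩
    c + suc (h + c * h) ≡⟨ arith c h ⟩
    suc c * suc h     ≤⟨ le ⟩
    a + suc m         ≡⟨ +-suc a m ⟩
    suc a + m         ≤⟨ +-monoˡ-≤ m (≰⇒> c≰a) ⟩
    c + m             ∎)) (subst (suc c * suc h ≤_) (+-suc a m) le)
  where
  open ≤-Reasoning
  arith : ∀ c h → c + suc (h + c * h) ≡ suc c * suc h
  arith = solve-∀

Dom-empty : ∀ {m} c a d (A : Subset m) → ∣ A ∣ ≤ d → Dom d (greedy c a zero m) A
Dom-empty c a d       []          le       = tt
Dom-empty c a d       (false ∷ A) le       = Dom-empty c a d A le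
Dom-empty c a (suc d) (true ∷ A)  (s≤s le) = Dom-empty c a d A le

-- When the greedy walk takes a coordinate that `A` skips, its height falls by `c + 1` relative to
-- that of `A` and the lead grows by 1; hence the invariant `b ≤ a + suc c * d`. Without lead it
-- says `b ≤ a`, so whatever `A` can take the greedy walk can take.
Dom-greedy : ∀ {m} c a b h d (A : Subset m) → bad c b A ≡ false → b ≤ a + suc c * d → ∣ A ∣ ≤ h + d →
  Dom d (greedy c a h m) A
Dom-greedy c a b h       d []          ok b≤ A≤ = tt
Dom-greedy c a b zero    d A@(_ ∷ _)   ok b≤ A≤ = Dom-empty c a d A A≤
Dom-greedy c a b (suc h) d (false ∷ A) ok b≤ A≤ with c ≤? a
... | yes c≤a = Dom-greedy c (a ∸ c) (suc b) h (suc d) A ok (begin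
    suc b                         ≤⟨ s≤s b≤ ⟩
    suc (a + suc c * d)           ≡⟨ cong (λ x → suc (x + suc c * d)) (sym (m∸n+n≡m c≤a)) ⟩
    suc (a ∸ c + c + suc c * d)   ≡⟨ arith (a ∸ c) c d ⟩
    a ∸ c + suc c * suc d         ∎) (subst (∣ A ∣ ≤_) (sym (+-suc h d)) A≤)
  where
  open ≤-Reasoning
  arith : ∀ x c d → suc (x + c + suc c * d) ≡ x + suc c * suc d
  arith = solve-∀
... | no _ = Dom-greedy c (suc a) (suc b) (suc h) d A ok (s≤s b≤) A≤
Dom-greedy c a b (suc h) d (true ∷ A) ok b≤ A≤ with c ≤? b | c ≤? a
... | no _    | _       = true≢false refl ok
... | yes c≤b | yes c≤a = Dom-greedy c (a ∸ c) (b ∸ c) h d A ok (begin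
    b ∸ c                 ≤⟨ ∸-monoˡ-≤ c b≤ ⟩
    a + suc c * d ∸ c     ≡⟨ +-∸-comm (suc c * d) c≤a ⟩
    a ∸ c + suc c * d     ∎) (≤-pred A≤)
  where open ≤-Reasoning
Dom-greedy c a b (suc h) zero    (true ∷ A) ok b≤ A≤ | yes c≤b | no c≰a =
  ⊥-elim (c≰a (≤-trans c≤b (≤-trans b≤ (≤-reflexive (trans (cong (a +_) (*-zeroʳ (suc c))) (+-identityʳ a))))))
Dom-greedy c a b (suc h) (suc d) (true ∷ A) ok b≤ A≤ | yes c≤b | no c≰a =
  Dom-greedy c (suc a) (b ∸ c) (suc h) d A ok
    (≤-trans (∸-monoˡ-≤ c b≤) (≤-reflexive (trans (cong (_∸ c) (arith a c d)) (m+n∸n≡m (suc a + suc c * d) c))))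
    (≤-pred (subst (suc ∣ A ∣ ≤_) (cong suc (+-suc h d)) A≤))
  where
  arith : ∀ a c d → a + suc c * suc d ≡ suc a + suc c * d + c
  arith = solve-∀

meets-emptyˡ : ∀ {m} c a (B : Subset m) → meets (greedy c a zero m) B ≡ false
meets-emptyˡ c a []      = refl
meets-emptyˡ c a (b ∷ B) = meets-emptyˡ c a B

meets-emptyʳ : ∀ {m} c a (B : Subset m) → meets B (greedy c a zero m) ≡ false
meets-emptyʳ c a B = trans (meets-sym B _) (meets-emptyˡ c a B)

-- Once it is at most c, the height of a greedy walk is its phase modulo c + 1,
-- and elements are taken in phase c only.
greedy-disjoint : ∀ c a a′ h h′ m → a ≤ c → a′ ≤ c → a ≢ a′ →
  meets (greedy c a h m) (greedy c a′ h′ m) ≡ false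
greedy-disjoint c a a′ h h′ zero _ _ _ = refl
greedy-disjoint c a a′ zero h′ (suc m) _ _ _ = meets-emptyˡ c a (greedy c a′ h′ (suc m))
greedy-disjoint c a a′ (suc h) zero (suc m) _ _ _ = meets-emptyʳ c a′ (greedy c a (suc h) (suc m))
greedy-disjoint c a a′ (suc h) (suc h′) (suc m) a≤c a′≤c a≢a′ with c ≤? a | c ≤? a′
... | yes c≤a | yes c≤a′ = ⊥-elim (a≢a′ (trans (≤-antisym a≤c c≤a) (≤-antisym c≤a′ a′≤c)))
... | yes c≤a | no c≰a′  = greedy-disjoint c (a ∸ c) (suc a′) h (suc h′) m
  (≤-trans (m∸n≤m a c) a≤c) (≰⇒> c≰a′) (λ eq → 0≢1+n (trans (sym (m≤n⇒m∸n≡0 a≤c)) eq))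
... | no c≰a  | yes c≤a′ = greedy-disjoint c (suc a) (a′ ∸ c) (suc h) h′ m
  (≰⇒> c≰a) (≤-trans (m∸n≤m a′ c) a′≤c) (λ eq → 0≢1+n (trans (sym (m≤n⇒m∸n≡0 a′≤c)) (sym eq)))
... | no c≰a  | no c≰a′  = greedy-disjoint c (suc a) (suc a′) (suc h) (suc h′) m
  (≰⇒> c≰a) (≰⇒> c≰a′) (a≢a′ ∘ suc-injective)

delayedGreedy : (c s a h m : ℕ) → Subset m
delayedGreedy c zero    a h m       = greedy c a h m
delayedGreedy c (suc s) a h zero    = []
delayedGreedy c (suc s) a h (suc m) = false ∷ delayedGreedy c s a h m

∣delayedGreedy∣ : ∀ c s a h m → s + suc c * h ≤ m → ∣ delayedGreedy c s a h m ∣ ≡ h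
∣delayedGreedy∣ c zero    a h m       le = ∣greedy∣ c a h m (≤-trans (m≤m+n h (c * h)) le) (≤-trans le (m≤n+m m a))
∣delayedGreedy∣ c (suc s) a h (suc m) (s≤s le) = ∣delayedGreedy∣ c s a h m le

-- From height `s * c + 1` the greedy walk takes the first `s` coordinates, as far as its elements
-- last, which are those that the delayed one skips. It is then at height 1, and the phases 1 and
-- `b` keep the rest apart.
greedy-disjoint-delayed : ∀ c s b h h′ m → 1 ≤ c → b ≤ c → b ≢ 1 →
  meets (greedy c (s * c + 1) h m) (delayedGreedy c s b h′ m) ≡ false
greedy-disjoint-delayed c zero    b h h′ m 1≤c b≤c b≢1 = greedy-disjoint c 1 b h h′ m 1≤c b≤c (b≢1 ∘ sym)
greedy-disjoint-delayed c (suc s) b h h′ zero _ _ _ = refl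
greedy-disjoint-delayed c (suc s) b zero h′ (suc m) _ _ _ = meets-emptyˡ c (suc s * c + 1) (delayedGreedy c (suc s) b h′ (suc m))
greedy-disjoint-delayed c (suc s) b (suc h) h′ (suc m) 1≤c b≤c b≢1 with c ≤? suc s * c + 1
... | no c≰ = ⊥-elim (c≰ (≤-trans (m≤m+n c (s * c)) (m≤m+n _ 1)))
... | yes _ = subst (λ a → meets (greedy c a h m) (delayedGreedy c s b h′ m) ≡ false)
  (sym (trans (cong (_∸ c) (+-assoc c (s * c) 1)) (m+n∸m≡n c (s * c + 1))))
  (greedy-disjoint-delayed c s b h h′ m 1≤c b≤c b≢1)

delayedGreedy-disjoint : ∀ c s a a′ h h′ m → a ≤ c → a′ ≤ c → a ≢ a′ →
  meets (delayedGreedy c s a h m) (delayedGreedy c s a′ h′ m) ≡ false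
delayedGreedy-disjoint c zero    a a′ h h′ m       p q r = greedy-disjoint c a a′ h h′ m p q r
delayedGreedy-disjoint c (suc s) a a′ h h′ zero    p q r = refl
delayedGreedy-disjoint c (suc s) a a′ h h′ (suc m) p q r = delayedGreedy-disjoint c s a a′ h h′ m p q r

Dom-delayed : ∀ {m} c s a h (A : Subset m) → 1 ≤ a → delayed c s 1 A ≡ true → ∣ A ∣ ≤ h →
  Dom 0 (delayedGreedy c s a h m) A
Dom-delayed {m} c zero a h A 1≤a ok A≤ with bad c 1 A in eq
... | false = Dom-greedy c a 1 h 0 A eq (≤-trans 1≤a (m≤m+n a _)) (≤-trans A≤ (m≤m+n h 0))
Dom-delayed c (suc s) a h []          1≤a ok A≤ = tt
Dom-delayed c (suc s) a h (false ∷ A) 1≤a ok A≤ = Dom-delayed c s a h A 1≤a ok A≤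

-- The lead of one pays for the skipped coordinate. If `A` takes that coordinate, the lead is spent
-- but the height of `A` falls to at most `1 ≤ a`; otherwise the lead admits heights up to
-- `a + c + 1`. So the walk of `A` may start as high as `c + 1`, not just at 1.
Dom-delayed-lead : ∀ {m} c a b h (A : Subset m) → 1 ≤ a → b ≤ suc c → bad c b A ≡ false → ∣ A ∣ ≤ suc h →
  Dom 1 (delayedGreedy c 1 a h m) A
Dom-delayed-lead c a b h []          1≤a b≤ ok A≤ = tt
Dom-delayed-lead c a b h (false ∷ A) 1≤a b≤ ok A≤ = Dom-greedy c a (suc b) h 1 A ok
  (≤-trans (s≤s b≤) (+-mono-≤ 1≤a (≤-reflexive (sym (*-identityʳ (suc c))))))
  (≤-trans A≤ (≤-reflexive (+-comm 1 h)))
Dom-delayed-lead c a b h (true ∷ A)  1≤a b≤ ok A≤ with c ≤? b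
... | yes c≤b = Dom-greedy c a (b ∸ c) h 0 A ok
  (≤-trans (∸-monoˡ-≤ c b≤) (≤-trans (≤-reflexive (m+n∸n≡m 1 c)) (≤-trans 1≤a (m≤m+n a _))))
  (≤-trans (≤-pred A≤) (m≤m+n h 0))
... | no _ = true≢false refl ok

∣++∣ : ∀ {w m} (P : Subset w) (Q : Subset m) → ∣ P ++ Q ∣ ≡ ∣ P ∣ + ∣ Q ∣
∣++∣ []          Q = refl
∣++∣ (false ∷ P) Q = ∣++∣ P Q
∣++∣ (true ∷ P)  Q = cong suc (∣++∣ P Q)

meets-++ : ∀ {w m} (P P′ : Subset w) (Q Q′ : Subset m) → meets P P′ ≡ false → meets Q Q′ ≡ false →
  meets (P ++ Q) (P′ ++ Q′) ≡ false
meets-++ []          []           Q Q′ p q = q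
meets-++ (true ∷ P)  (false ∷ P′) Q Q′ p q = meets-++ P P′ Q Q′ p q
meets-++ (false ∷ P) (x ∷ P′)     Q Q′ p q = meets-++ P P′ Q Q′ p q

meets-⊥ˡ : ∀ {n} (A : Subset n) → meets ⊥ A ≡ false
meets-⊥ˡ []      = refl
meets-⊥ˡ (a ∷ A) = meets-⊥ˡ A

meets-⊥ʳ : ∀ {n} (A : Subset n) → meets A ⊥ ≡ false
meets-⊥ʳ A = trans (meets-sym A ⊥) (meets-⊥ˡ A)

meets-⁅⁆ : ∀ {n} {u v : Fin n} → u ≢ v → meets ⁅ u ⁆ ⁅ v ⁆ ≡ false
meets-⁅⁆ {u = zero}  {zero}  u≢v = ⊥-elim (u≢v refl)
meets-⁅⁆ {u = zero}  {suc v} u≢v = meets-⊥ˡ ⁅ v ⁆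
meets-⁅⁆ {u = suc u} {zero}  u≢v = meets-⊥ʳ ⁅ u ⁆
meets-⁅⁆ {u = suc u} {suc v} u≢v = meets-⁅⁆ (u≢v ∘ cong suc)

Dom-++ : ∀ {w m} d (P : Subset w) {B A : Subset m} → Dom d B A → Dom d (P ++ B) (P ++ A)
Dom-++ d []          dom = dom
Dom-++ d (false ∷ P) dom = Dom-++ d P dom
Dom-++ d (true ∷ P)  dom = Dom-++ d P dom

Dom-⁅⁆++ : ∀ {w m} (u : Fin w) {B A : Subset m} → Dom 1 B A → Dom 0 (⁅ u ⁆ ++ B) (⊥ {w} ++ A)
Dom-⁅⁆++ {suc w} zero    dom = Dom-++ 1 (⊥ {w}) dom
Dom-⁅⁆++         (suc u) dom = Dom-⁅⁆++ u dom

-- Shifted families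

CrossFree : ∀ {t n} → (Fin t → Family n) → Set
CrossFree {t} {n} F = (A : Fin t → Subset n) → (∀ i → F i (A i) ≡ true) →
  ¬ (∀ i j → i ≢ j → meets (A i) (A j) ≡ false)

card-prefix : ∀ {w m} (G : Family (w + m)) (P : Subset w) → card (λ Q → G (P ++ Q)) ≤ card G
card-prefix G []          = ≤-refl
card-prefix G (false ∷ P) = ≤-trans (card-prefix (G ∘ (false ∷_)) P) (m≤m+n _ _)
card-prefix G (true ∷ P)  = ≤-trans (card-prefix (G ∘ (true ∷_)) P) (m≤n+m _ _)

initial : ∀ w m → Subset (w + m)
initial w m = ⊤ {w} ++ ⊥ {m}

∣initial∣ : ∀ w m → ∣ initial w m ∣ ≡ w
∣initial∣ w m = trans (∣++∣ (⊤ {w}) (⊥ {m})) (trans (cong₂ _+_ (∣⊤∣≡n w) (∣⊥∣≡0 m)) (+-identityʳ w))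

card-outside : ∀ w m (G : Family (w + m)) →
  card (λ A → G A ∧ not (meets A (initial w m))) ≤ card (λ Q → G (⊥ {w} ++ Q))
card-outside zero    m G = card-mono {m} (λ A → proj₁ ∘ ∧-true)
card-outside (suc w) m G = begin
  card (λ A → G (false ∷ A) ∧ not (meets A (initial w m))) + card (λ A → G (true ∷ A) ∧ false)
    ≡⟨ cong (card (λ A → G (false ∷ A) ∧ not (meets A (initial w m))) +_) (card-false {w + m} (λ A → ∧-zeroʳ (G (true ∷ A)))) ⟩
  card (λ A → G (false ∷ A) ∧ not (meets A (initial w m))) + 0
    ≡⟨ +-identityʳ _ ⟩
  card (λ A → G (false ∷ A) ∧ not (meets A (initial w m)))
    ≤⟨ card-outside w m (G ∘ (false ∷_)) ⟩
  card (λ Q → G (⊥ {suc w} ++ Q)) ∎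
  where open ≤-Reasoning

outside-initial : ∀ w m (A : Subset (w + m)) → meets A (initial w m) ≡ false → ∃ λ Q → A ≡ ⊥ {w} ++ Q
outside-initial zero    m A           h = A , refl
outside-initial (suc w) m (false ∷ A) h with outside-initial w m A h
... | Q , refl = Q , refl

⁅⁆-meets-initial : ∀ {w m} (u : Fin w) (Q : Subset m) → meets (⁅ u ⁆ ++ Q) (initial w m) ≡ true
⁅⁆-meets-initial zero    Q = refl
⁅⁆-meets-initial (suc u) Q = ⁅⁆-meets-initial u Q

-- `X` is pinned from both sides: `room` lets the walk estimates apply with base `X`, and `m≤`
-- bounds what passing from `k`-sets to `h`-sets costs.
module ClosedCase
  (w m h X κ : ℕ)
  (2≤X : 2 ≤ X) (κ<X : 8 * κ < X)
  (room : (2 * X ^ suc (suc w) + 1 + suc (suc w)) * suc h + suc h ≤ m)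
  (m≤ : m ≤ κ * X ^ suc (suc w) * suc h)
  (F : Fin (suc w) → Family (w + m))
  (uniform : ∀ i A → F i A ≡ true → ∣ A ∣ ≡ suc h)
  (crossFree : CrossFree F)
  (closed : ∀ i → Closed (F i))
  (large : ∀ i → card (star (suc h) (initial w m)) ≤ card (F i))
  where

  open ≤-Reasoning

  k t c : ℕ
  k = suc h
  t = suc w
  c = suc t

  instance
    X≢0 : NonZero X
    X≢0 = >-nonZero (≤-trans (s≤s z≤n) 2≤X)

  c<2X^c+1+c : suc c ≤ 2 * X ^ c + 1 + c
  c<2X^c+1+c = +-monoˡ-≤ c (m≤n+m 1 (2 * X ^ c))

  R : Fin t → Family m
  R j Q = F j (⊥ {w} ++ Q)

  ∣⊥++∣ : ∀ (Q : Subset m) → ∣ ⊥ {w} ++ Q ∣ ≡ ∣ Q ∣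
  ∣⊥++∣ Q = trans (∣++∣ (⊥ {w}) Q) (cong (_+ ∣ Q ∣) (∣⊥∣≡0 w))

  ∣⁅⁆++∣ : ∀ (u : Fin w) (Q : Subset m) → ∣ ⁅ u ⁆ ++ Q ∣ ≡ suc ∣ Q ∣
  ∣⁅⁆++∣ u Q = trans (∣++∣ ⁅ u ⁆ Q) (cong (_+ ∣ Q ∣) (∣⁅x⁆∣≡1 u))

  ∣R∣ : ∀ j Q → R j Q ≡ true → ∣ Q ∣ ≡ k
  ∣R∣ j Q RQ = trans (sym (∣⊥++∣ Q)) (uniform j _ RQ)

  spread : ℕ → Subset m
  spread s = greedy c (s * c + 1) k m

  -- Phase 1 belongs to `spread`, so the threads get the phases 2 to `t + 1`, one for each index;
  -- this is why `c = t + 1`.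
  thread : Fin t → ℕ → Subset m
  thread j s = delayedGreedy c s (2 + toℕ j) h m

  ∣spread∣ : ∀ s → ∣ spread s ∣ ≡ k
  ∣spread∣ s = ∣greedy∣ c (s * c + 1) k m (≤-trans (m≤n+m k _) room)
    (≤-trans (*-monoˡ-≤ k c<2X^c+1+c) (≤-trans (m≤m+n _ k) (≤-trans room (m≤n+m m _))))

  thread-room : ∀ s → s ≤ k → s + (2 * X ^ c + 1 + c) * h ≤ m
  thread-room s s≤k = begin
    s + (2 * X ^ c + 1 + c) * h ≤⟨ +-mono-≤ s≤k (*-monoʳ-≤ (2 * X ^ c + 1 + c) (n≤1+n h)) ⟩
    k + (2 * X ^ c + 1 + c) * k ≡⟨ +-comm k _ ⟩
    (2 * X ^ c + 1 + c) * k + k ≤⟨ room ⟩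
    m ∎

  ∣thread∣ : ∀ j s → s ≤ k → ∣ thread j s ∣ ≡ h
  ∣thread∣ j s s≤k = ∣delayedGreedy∣ c s (2 + toℕ j) h m
    (≤-trans (+-monoʳ-≤ s (*-monoˡ-≤ h c<2X^c+1+c)) (thread-room s s≤k))

  lost : ℕ → Family m
  lost s Q = sized h Q ∧ delayed c s 1 Q

  -- If ⁅ u ⁆ ++ thread j s is missing from F j, so is ⁅ u ⁆ ++ Q for each Q in lost s,
  -- and F j is large enough only if R j makes up for that.
  card-lost : ∀ j u s → s ≤ k → F j (⁅ u ⁆ ++ thread j s) ≡ false → card (lost s) ≤ card (R j)
  card-lost j u s s≤k missing = +-cancelˡ-≤ (card (λ A → Star A ∧ F j A)) _ _ (begin
    card (λ A → Star A ∧ F j A) + card (lost s)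
      ≤⟨ +-monoʳ-≤ (card (λ A → Star A ∧ F j A)) (≤-trans (card-mono {m} lost⇒) (card-prefix (λ A → Star A ∧ not (F j A)) ⁅ u ⁆)) ⟩
    card (λ A → Star A ∧ F j A) + card (λ A → Star A ∧ not (F j A))
      ≡⟨ sym (card-split Star (F j)) ⟩
    card Star
      ≤⟨ large j ⟩
    card (F j)
      ≡⟨ card-split (F j) Star ⟩
    card (λ A → F j A ∧ Star A) + card (λ A → F j A ∧ not (Star A))
      ≤⟨ +-mono-≤ (card-mono {w + m} swap) (≤-trans (card-mono {w + m} outside) (card-outside w m (F j))) ⟩
    card (λ A → Star A ∧ F j A) + card (R j) ∎)
    where
    Star : Family (w + m)
    Star = star k (initial w m)
    swap : ∀ A → (F j A ∧ Star A) ≡ true → (Star A ∧ F j A) ≡ true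
    swap A e with ∧-true {F j A} e
    ... | p , q = ∧-intro {Star A} q p
    outside : ∀ A → (F j A ∧ not (Star A)) ≡ true → (F j A ∧ not (meets A (initial w m))) ≡ true
    outside A e with F j A in FA
    ... | true rewrite ≡⇒sized k A (uniform j A FA) = e
    lost⇒ : ∀ Q → lost s Q ≡ true → (Star (⁅ u ⁆ ++ Q) ∧ not (F j (⁅ u ⁆ ++ Q))) ≡ true
    lost⇒ Q e with ∧-true e
    ... | szQ , dQ = ∧-intro (∧-intro (≡⇒sized k (⁅ u ⁆ ++ Q) (trans (∣⁅⁆++∣ u Q) (cong suc ∣Q∣))) (⁅⁆-meets-initial u Q))
                             (cong not (¬true⇒false absent))
      where
      ∣Q∣ : ∣ Q ∣ ≡ h
      ∣Q∣ = sized⇒≡ h Q szQ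
      absent : ¬ (F j (⁅ u ⁆ ++ Q) ≡ true)
      absent FQ = true≢false (Closed⇒Dom-closed (closed j) _ _
        (Dom-++ 0 ⁅ u ⁆ (Dom-delayed c s (2 + toℕ j) h Q (s≤s z≤n) dQ (≤-reflexive ∣Q∣)))
        (trans (∣⁅⁆++∣ u Q) (trans (cong suc (trans ∣Q∣ (sym (∣thread∣ j s s≤k)))) (sym (∣⁅⁆++∣ u (thread j s))))) FQ) missing

  -- κ X^c bounds m / k, so this beats the ratio between binom m k and binom m h,
  -- diminished by the factor 2 ^ (3 + q) of delayed-count.
  exponent-gap : ∀ q → κ * X ^ c * 2 ^ (3 + q) < X ^ (suc q * c + 1)
  exponent-gap q = begin-strict
    κ * X ^ c * 2 ^ (3 + q)       ≡⟨ arith κ (X ^ c) (2 ^ q) ⟩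
    8 * κ * (X ^ c * 2 ^ q)       <⟨ *-monoˡ-< (X ^ c * 2 ^ q) ⦃ m*n≢0 (X ^ c) (2 ^ q) ⦃ m^n≢0 X c ⦄ ⦃ m^n≢0 2 q ⦄ ⦄ κ<X ⟩
    X * (X ^ c * 2 ^ q)           ≤⟨ *-monoʳ-≤ X (*-monoʳ-≤ (X ^ c) (≤-trans (^-monoˡ-≤ q 2≤X) (^-monoʳ-≤ X (m≤m*n q c)))) ⟩
    X * (X ^ c * X ^ (q * c))     ≡⟨ cong (X *_) (sym (^-distribˡ-+-* X c (q * c))) ⟩
    X ^ suc (suc q * c)           ≡⟨ cong (X ^_) (+-comm 1 (suc q * c)) ⟩
    X ^ (suc q * c + 1)           ∎
    where
    arith : ∀ κ x y → κ * x * (2 * (2 * (2 * y))) ≡ 8 * κ * (x * y)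
    arith = solve-∀

  -- If the thread were missing, `card-lost` and `delayed-count` would give `R j` at least
  -- `binom m h / 2 ^ (s + 1)` sets. But `small` together with `k * binom m k ≤ m * binom m h`
  -- leaves fewer, by `exponent-gap`.
  thread∈ : ∀ q s → s ≤ suc (suc q) → s ≤ k → ∀ j →
    X ^ (suc q * c + 1) * card (R j) ≤ binom m k → ∀ u → F j (⁅ u ⁆ ++ thread j s) ≡ true
  thread∈ q s s≤q s≤k j small u with F j (⁅ u ⁆ ++ thread j s) in missing
  ... | true  = refl
  ... | false = ⊥-elim (<⇒≱ (exponent-gap q) (*-cancelʳ-≤ _ _ (k * ℓ) ⦃ m*n≢0 k ℓ ⦄ (begin
    X ^ (suc q * c + 1) * (k * ℓ)       ≡⟨ arith (X ^ (suc q * c + 1)) k ℓ ⟩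
    k * (X ^ (suc q * c + 1) * ℓ)       ≤⟨ *-monoʳ-≤ k (*-monoʳ-≤ (X ^ (suc q * c + 1)) (card-lost j u s s≤k missing)) ⟩
    k * (X ^ (suc q * c + 1) * card (R j)) ≤⟨ *-monoʳ-≤ k small ⟩
    k * binom m k                       ≤⟨ m≤m+n _ (h * binom m h) ⟩
    k * binom m k + h * binom m h       ≡⟨ binom-absorb m h ⟩
    m * binom m h                       ≤⟨ *-mono-≤ m≤ (delayed-count c X 2≤X m s h (thread-room s s≤k)) ⟩
    κ * X ^ c * k * (2 ^ suc s * ℓ)     ≤⟨ *-monoʳ-≤ (κ * X ^ c * k) (*-monoˡ-≤ ℓ (^-monoʳ-≤ 2 (s≤s s≤q))) ⟩
    κ * X ^ c * k * (2 ^ (3 + q) * ℓ)   ≡⟨ arith₂ (κ * X ^ c) k (2 ^ (3 + q)) ℓ ⟩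
    κ * X ^ c * 2 ^ (3 + q) * (k * ℓ)   ∎)))
    where
    ℓ : ℕ
    ℓ = card (lost s)
    arith : ∀ x k l → x * (k * l) ≡ k * (x * l)
    arith = solve-∀
    arith₂ : ∀ x k y l → x * k * (y * l) ≡ x * y * (k * l)
    arith₂ = solve-∀
    h≤m : h ≤ m
    h≤m = ≤-trans (n≤1+n h) (≤-trans (m≤n+m k _) room)
    instance
      -- Nonemptiness of `lost s` comes from `delayed-count`; it permits cancelling `k * ℓ` to
      -- contradict the strict `exponent-gap`.
      ℓ≢0 : NonZero ℓ
      ℓ≢0 = m*n≢0⇒n≢0 (2 ^ suc s) ⦃ >-nonZero (≤-trans (binom-pos h≤m) (delayed-count c X 2≤X m s h (thread-room s s≤k))) ⦄

  R-small : ∀ j a → (∀ Q → R j Q ≡ true → bad c a Q ≡ true) → X ^ a * card (R j) ≤ binom m k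
  R-small j a R⊆bad = ≤-trans
    (*-monoʳ-≤ (X ^ a) (card-mono {m} (λ Q RQ → ∧-intro (≡⇒sized k Q (∣R∣ j Q RQ)) (R⊆bad Q RQ))))
    (badCount-bound c X 2≤X m k a (≤-trans (m≤m+n _ k) (≤-trans room (m≤m+n m a))))

  -- `spread s` dominates every `k`-set whose walk from height `s * c + 1` survives.
  R⊆bad : ∀ j s → R j (spread s) ≡ false → ∀ Q → R j Q ≡ true → bad c (s * c + 1) Q ≡ true
  R⊆bad j s missing Q RQ = ¬false⇒true (λ ok → true≢false (Closed⇒Dom-closed (closed j) _ _
    (Dom-++ 0 (⊥ {w}) (Dom-greedy c (s * c + 1) (s * c + 1) k 0 Q ok (m≤m+n _ _)
      (≤-trans (≤-reflexive (∣R∣ j Q RQ)) (m≤m+n k 0))))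
    (trans (uniform j _ RQ) (sym (trans (∣⊥++∣ (spread s)) (∣spread∣ s)))) RQ) missing)

  -- A missing thread forces R j into the bad sets of height c + 1, so that R j is too small
  -- for a thread to be missing.
  first-thread∈ : ∀ j u → F j (⁅ u ⁆ ++ thread j 1) ≡ true
  first-thread∈ j u with F j (⁅ u ⁆ ++ thread j 1) in missing
  ... | true  = refl
  ... | false = trans (sym missing) (thread∈ 0 1 (s≤s z≤n) (s≤s z≤n) j
    (R-small j (1 * c + 1) (λ Q RQ → ¬false⇒true (λ ok → true≢false (Closed⇒Dom-closed (closed j) _ _
      (Dom-⁅⁆++ u (Dom-delayed-lead c (2 + toℕ j) (1 * c + 1) h Q (s≤s z≤n)
        (≤-reflexive (trans (cong (_+ 1) (*-identityˡ c)) (+-comm c 1))) ok (≤-reflexive (∣R∣ j Q RQ))))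
      (trans (uniform j _ RQ) (sym (trans (∣⁅⁆++∣ u (thread j 1)) (cong suc (∣thread∣ j 1 (s≤s z≤n)))))) RQ) missing))) u)

  spread∉ : ∀ s → (∀ j u → F j (⁅ u ⁆ ++ thread j s) ≡ true) → ∀ i → R i (spread s) ≡ false
  spread∉ s threads i = ¬true⇒false (λ Ri → crossFree A (member Ri) disjoint)
    where
    A : Fin t → Subset (w + m)
    -- `punchOut` matches the `t - 1` indices other than `i` with the elements of the initial
    -- segment, so each thread gets its own `u`.
    A j with i ≟ᶠ j
    ... | yes _   = ⊥ {w} ++ spread s
    ... | no i≢j  = ⁅ punchOut i≢j ⁆ ++ thread j s
    member : R i (spread s) ≡ true → ∀ j → F j (A j) ≡ true
    member Ri j with i ≟ᶠ j
    ... | yes refl = Ri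
    ... | no i≢j   = threads j (punchOut i≢j)
    2+toℕ≤c : ∀ (j : Fin t) → 2 + toℕ j ≤ c
    2+toℕ≤c j = s≤s (toℕ<n j)
    spread-thread : ∀ j → meets (spread s) (thread j s) ≡ false
    spread-thread j = greedy-disjoint-delayed c s (2 + toℕ j) k h m (s≤s z≤n) (2+toℕ≤c j) (λ ())
    disjoint : ∀ j j′ → j ≢ j′ → meets (A j) (A j′) ≡ false
    disjoint j j′ j≢j′ with i ≟ᶠ j | i ≟ᶠ j′
    ... | yes refl | yes refl = ⊥-elim (j≢j′ refl)
    ... | yes refl | no i≢j′  = meets-++ (⊥ {w}) ⁅ punchOut i≢j′ ⁆ _ _ (meets-⊥ˡ ⁅ punchOut i≢j′ ⁆) (spread-thread j′)
    ... | no i≢j   | yes refl = meets-++ ⁅ punchOut i≢j ⁆ (⊥ {w}) _ _ (meets-⊥ʳ ⁅ punchOut i≢j ⁆)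
                                  (trans (meets-sym (thread j s) (spread s)) (spread-thread j))
    ... | no i≢j   | no i≢j′  = meets-++ ⁅ punchOut i≢j ⁆ ⁅ punchOut i≢j′ ⁆ _ _
      (meets-⁅⁆ (j≢j′ ∘ punchOut-injective i≢j i≢j′))
      (delayedGreedy-disjoint c s _ _ h h m (2+toℕ≤c j) (2+toℕ≤c j′) (j≢j′ ∘ toℕ-injective ∘ suc-injective ∘ suc-injective))

  -- The induction cannot start at `spread 0`: excluding it would save only a factor `X`, not enough
  -- against the `X ^ c` in `exponent-gap`. Hence the separate argument for the first threads.
  no-spread : ∀ s → suc s ≤ k → ∀ i → R i (spread (suc s)) ≡ false
  no-spread zero    s<k = spread∉ 1 first-thread∈
  no-spread (suc s) s<k = spread∉ (suc (suc s)) (λ j → thread∈ s (suc (suc s)) ≤-refl s<k j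
    (R-small j (suc s * c + 1) (R⊆bad j (suc s) (no-spread s (<⇒≤ s<k) j))))

  R-empty : ∀ i Q → R i Q ≡ false
  R-empty i Q = ¬true⇒false (λ RQ → true≢false (R⊆bad i k (no-spread h ≤-refl i) Q RQ)
    (bad-high c (k * c + 1) Q (≤-trans (≤-reflexive (trans (cong (c *_) (∣R∣ i Q RQ)) (*-comm c k))) (m≤m+n (k * c) 1))))

  F⊆star : ∀ i A → F i A ≡ true → star k (initial w m) A ≡ true
  F⊆star i A FA = ∧-intro (≡⇒sized k A (uniform i A FA)) (¬false⇒true meets-U)
    where
    meets-U : ¬ (meets A (initial w m) ≡ false)
    meets-U dj with outside-initial w m A dj
    ... | Q , refl = true≢false FA (R-empty i Q)

  isStar : ∀ i A → F i A ≡ star k (initial w m) A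
  isStar i A with F i A in FA | star k (initial w m) A in SA
  ... | true  | true  = refl
  ... | false | false = refl
  ... | true  | false = trans (sym (F⊆star i A FA)) SA
  ... | false | true  = trans (sym FA) (card-full⇒⊇ (F i) (star k (initial w m)) (F⊆star i) (large i) A SA)

-- Undoing a shift

meets-⁅⁆ˡ : ∀ {n} x (B : Subset n) → meets ⁅ x ⁆ B ≡ lookup B x
meets-⁅⁆ˡ zero    (true ∷ B)  = refl
meets-⁅⁆ˡ zero    (false ∷ B) = meets-⊥ˡ B
meets-⁅⁆ˡ (suc x) (b ∷ B)     = meets-⁅⁆ˡ x B

lookup⇒meets : ∀ {n} x (A B : Subset n) → lookup A x ≡ true → lookup B x ≡ true → meets A B ≡ true
lookup⇒meets zero    (true ∷ A) (true ∷ B) _ _ = refl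
lookup⇒meets (suc x) (a ∷ A) (b ∷ B) p q = trans (cong ((a ∧ b) ∨_) (lookup⇒meets x A B p q)) (∨-zeroʳ (a ∧ b))

disjoint⇒lookup : ∀ {n} x (A B : Subset n) → meets A B ≡ false → lookup B x ≡ true → lookup A x ≡ false
disjoint⇒lookup x A B dj Bx = ¬true⇒false (λ Ax → true≢false (lookup⇒meets x A B Ax Bx) dj)

meets⇒lookup : ∀ {n} (A B : Subset n) → meets A B ≡ true → ∃ λ x → lookup A x ≡ true × lookup B x ≡ true
meets⇒lookup [] [] ()
meets⇒lookup (true ∷ A) (true ∷ B) _ = zero , refl , refl
meets⇒lookup (true ∷ A) (false ∷ B) m with meets⇒lookup A B m
... | x , p , q = suc x , p , q
meets⇒lookup (false ∷ A) (b ∷ B) m with meets⇒lookup A B m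
... | x , p , q = suc x , p , q

meets-∪ : ∀ {n} (A B D : Subset n) → meets (A ∪ B) D ≡ meets A D ∨ meets B D
meets-∪ []          []          []          = refl
meets-∪ (true ∷ A)  (b ∷ B)     (true ∷ D)  = refl
meets-∪ (false ∷ A) (true ∷ B)  (true ∷ D)  = sym (∨-zeroʳ (meets A D))
meets-∪ (false ∷ A) (false ∷ B) (c ∷ D)     = meets-∪ A B D
meets-∪ (true ∷ A)  (true ∷ B)  (false ∷ D) = meets-∪ A B D
meets-∪ (true ∷ A)  (false ∷ B) (false ∷ D) = meets-∪ A B D
meets-∪ (false ∷ A) (true ∷ B)  (false ∷ D) = meets-∪ A B D

∪-disjoint : ∀ {n} (A B D : Subset n) → meets A D ≡ false → meets B D ≡ false → meets (A ∪ B) D ≡ false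
∪-disjoint A B D p q = trans (meets-∪ A B D) (cong₂ _∨_ p q)

disjoint-∪ : ∀ {n} (D A B : Subset n) → meets D A ≡ false → meets D B ≡ false → meets D (A ∪ B) ≡ false
disjoint-∪ D A B p q = trans (meets-sym D (A ∪ B)) (∪-disjoint A B D (trans (meets-sym A D) p) (trans (meets-sym B D) q))

disjoint-∪⁻ : ∀ {n} (D A B : Subset n) → meets D (A ∪ B) ≡ false → meets D A ≡ false × meets D B ≡ false
disjoint-∪⁻ D A B h with ∨-false {meets A D} (trans (sym (meets-∪ A B D)) (trans (meets-sym (A ∪ B) D) h))
... | p , q = trans (meets-sym D A) p , trans (meets-sym D B) q

∣∪∣≤ : ∀ {n} (A B : Subset n) → ∣ A ∪ B ∣ ≤ ∣ A ∣ + ∣ B ∣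
∣∪∣≤ []          []          = z≤n
∣∪∣≤ (true ∷ A)  (true ∷ B)  = s≤s (≤-trans (∣∪∣≤ A B) (+-monoʳ-≤ ∣ A ∣ (n≤1+n ∣ B ∣)))
∣∪∣≤ (true ∷ A)  (false ∷ B) = s≤s (∣∪∣≤ A B)
∣∪∣≤ (false ∷ A) (true ∷ B)  = subst (suc ∣ A ∪ B ∣ ≤_) (sym (+-suc ∣ A ∣ ∣ B ∣)) (s≤s (∣∪∣≤ A B))
∣∪∣≤ (false ∷ A) (false ∷ B) = ∣∪∣≤ A B

∣⊎∣ : ∀ {n} (A B : Subset n) → meets A B ≡ false → ∣ A ∪ B ∣ ≡ ∣ A ∣ + ∣ B ∣
∣⊎∣ []          []          dj = refl
∣⊎∣ (true ∷ A)  (false ∷ B) dj = cong suc (∣⊎∣ A B dj)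
∣⊎∣ (false ∷ A) (true ∷ B)  dj = trans (cong suc (∣⊎∣ A B dj)) (sym (+-suc ∣ A ∣ ∣ B ∣))
∣⊎∣ (false ∷ A) (false ∷ B) dj = ∣⊎∣ A B dj

∣⁅x⁆∪A∣ : ∀ {n} x (A : Subset n) → lookup A x ≡ false → ∣ ⁅ x ⁆ ∪ A ∣ ≡ suc ∣ A ∣
∣⁅x⁆∪A∣ x A x∉A = trans (∣⊎∣ ⁅ x ⁆ A (trans (meets-⁅⁆ˡ x A) x∉A)) (cong (_+ ∣ A ∣) (∣⁅x⁆∣≡1 x))

meets⇒nonempty : ∀ {n} (A U : Subset n) → meets A U ≡ true → 1 ≤ ∣ U ∣
meets⇒nonempty [] [] ()
meets⇒nonempty (true ∷ A)  (true ∷ U)  m = s≤s z≤n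
meets⇒nonempty (true ∷ A)  (false ∷ U) m = meets⇒nonempty A U m
meets⇒nonempty (false ∷ A) (true ∷ U)  m = s≤s z≤n
meets⇒nonempty (false ∷ A) (false ∷ U) m = meets⇒nonempty A U m

avoiding : ∀ {n} h (Q : Subset n) → h + ∣ Q ∣ ≤ n → ∃ λ W → ∣ W ∣ ≡ h × meets W Q ≡ false
avoiding {n} zero Q le = ⊥ , ∣⊥∣≡0 n , meets-⊥ˡ Q
avoiding {suc n} (suc h) (false ∷ Q) (s≤s le) with avoiding h Q le
... | W , p , q = true ∷ W , cong suc p , q
avoiding {suc n} (suc h) (true ∷ Q) (s≤s le) with avoiding (suc h) Q (subst (_≤ n) (+-suc h ∣ Q ∣) le)
... | W , p , q = false ∷ W , p , q
avoiding {zero} (suc h) [] ()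

disjointAvoiding : ∀ {n} v h (Q : Subset n) → v * h + ∣ Q ∣ ≤ n →
  ∃ λ (W : Fin v → Subset n) → (∀ i → ∣ W i ∣ ≡ h) × (∀ i → meets (W i) Q ≡ false) ×
    (∀ i j → i ≢ j → meets (W i) (W j) ≡ false)
disjointAvoiding zero h Q le = (λ ()) , (λ ()) , (λ ()) , (λ ())
disjointAvoiding {n} (suc v) h Q le with avoiding h Q (≤-trans (+-monoˡ-≤ ∣ Q ∣ (m≤m+n h (v * h))) le)
... | W₀ , ∣W₀∣ , W₀Q with disjointAvoiding v h (W₀ ∪ Q) (begin
        v * h + ∣ W₀ ∪ Q ∣       ≤⟨ +-monoʳ-≤ (v * h) (∣∪∣≤ W₀ Q) ⟩
        v * h + (∣ W₀ ∣ + ∣ Q ∣) ≡⟨ cong (λ x → v * h + (x + ∣ Q ∣)) ∣W₀∣ ⟩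
        v * h + (h + ∣ Q ∣)      ≡⟨ arith v h ∣ Q ∣ ⟩
        suc v * h + ∣ Q ∣        ≤⟨ le ⟩
        n                        ∎)
  where
  open ≤-Reasoning
  arith : ∀ v h q → v * h + (h + q) ≡ suc v * h + q
  arith = solve-∀
... | W , ∣W∣ , WQ , WW = W′ , sizes , avoids , pairwise
  where
  W′ : Fin (suc v) → Subset n
  W′ zero    = W₀
  W′ (suc i) = W i
  sizes : ∀ i → ∣ W′ i ∣ ≡ h
  sizes zero    = ∣W₀∣
  sizes (suc i) = ∣W∣ i
  avoids : ∀ i → meets (W′ i) Q ≡ false
  avoids zero    = W₀Q
  avoids (suc i) = proj₂ (disjoint-∪⁻ (W i) W₀ Q (WQ i))
  pairwise : ∀ i j → i ≢ j → meets (W′ i) (W′ j) ≡ false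
  pairwise zero    zero    i≢j = ⊥-elim (i≢j refl)
  pairwise zero    (suc j) i≢j = trans (meets-sym W₀ (W j)) (proj₁ (disjoint-∪⁻ (W j) W₀ Q (WQ j)))
  pairwise (suc i) zero    i≢j = proj₁ (disjoint-∪⁻ (W i) W₀ Q (WQ i))
  pairwise (suc i) (suc j) i≢j = WW i j (i≢j ∘ cong suc)

enumerate : ∀ {n} v (Y : Subset n) → v ≤ ∣ Y ∣ →
  ∃ λ (e : Fin v → Fin n) → (∀ i → lookup Y (e i) ≡ true) × (∀ i j → e i ≡ e j → i ≡ j)
enumerate zero Y le = (λ ()) , (λ ()) , (λ ())
enumerate (suc v) [] ()
enumerate {suc n} (suc v) (true ∷ Y) (s≤s le) with enumerate v Y le
... | e , e∈ , inj = e′ , e′∈ , inj′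
  where
  e′ : Fin (suc v) → Fin (suc n)
  e′ zero    = zero
  e′ (suc i) = suc (e i)
  e′∈ : ∀ i → lookup (true ∷ Y) (e′ i) ≡ true
  e′∈ zero    = refl
  e′∈ (suc i) = e∈ i
  inj′ : ∀ i j → e′ i ≡ e′ j → i ≡ j
  inj′ zero    zero    _  = refl
  inj′ (suc i) (suc j) eq = cong suc (inj i j (sucᶠ-injective eq))
enumerate {suc n} (suc v) (false ∷ Y) le with enumerate (suc v) Y le
... | e , e∈ , inj = suc ∘ e , e∈ , λ i j eq → inj i j (sucᶠ-injective eq)

∩-self : ∀ {n} (U : Subset n) → ∣ U ∣ ≤ ∣ U ∩ U ∣
∩-self []          = z≤n
∩-self (true ∷ U)  = s≤s (∩-self U)
∩-self (false ∷ U) = ∩-self U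

∩-swap : ∀ {n} p (U : Subset n) → ∣ U ∣ ≤ suc ∣ U ∩ swapAt p U ∣
∩-swap zero    []                  = z≤n
∩-swap zero    (true ∷ [])         = s≤s z≤n
∩-swap zero    (false ∷ [])        = z≤n
∩-swap zero    (true ∷ true ∷ U)   = s≤s (s≤s (m≤n⇒m≤1+n (∩-self U)))
∩-swap zero    (true ∷ false ∷ U)  = s≤s (∩-self U)
∩-swap zero    (false ∷ true ∷ U)  = s≤s (∩-self U)
∩-swap zero    (false ∷ false ∷ U) = m≤n⇒m≤1+n (∩-self U)
∩-swap (suc p) []                  = z≤n
∩-swap (suc p) (true ∷ U)          = s≤s (∩-swap p U)
∩-swap (suc p) (false ∷ U)         = ∩-swap p U

-- On each pair of swapped sets, `F i` agrees with the star of `U` or with its swap. What has to be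
-- shown is that one choice serves all pairs and all families.
module Unshift
  (n v h p : ℕ)
  (room : suc v * suc h + (suc v + suc v) + (suc h + suc h + suc h) ≤ n)
  (F : Fin (suc (suc v)) → Family n)
  (uniform : ∀ i A → F i A ≡ true → ∣ A ∣ ≡ suc h)
  (crossFree : CrossFree F)
  (U : Subset n) (∣U∣ : ∣ U ∣ ≡ suc v)
  (shifted : ∀ i A → shiftAt p (F i) A ≡ star (suc h) U A)
  where

  k w : ℕ
  k = suc h
  w = suc v

  τ : Subset n → Subset n
  τ = swapAt p

  ττ : ∀ A → τ (τ A) ≡ A
  ττ = swap-involutive p

  meets-τ : ∀ A B → meets (τ A) B ≡ meets A (τ B)
  meets-τ A B = trans (cong (meets (τ A)) (sym (ττ B))) (meets-swap p A (τ B))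

  star-τ : ∀ A → star k (τ U) A ≡ star k U (τ A)
  star-τ A = cong₂ _∧_ (cong (_≡ᵇ k) (sym (∣swap∣ p A))) (sym (meets-τ A U))

  F⇒star : ∀ i A → F i A ≡ true → star k U A ≡ true ⊎ star k U (τ A) ≡ true
  F⇒star i A FA with shift-dichotomy p (F i) A
  ... | inj₁ (e , _) = inj₁ (trans (sym (shifted i A)) (trans e FA))
  ... | inj₂ (_ , e) = inj₂ (trans (sym (shifted i (τ A))) (trans e FA))

  star⇒F : ∀ i A → star k U A ≡ true → F i A ≡ true ⊎ F i (τ A) ≡ true
  star⇒F i A SA with shift-dichotomy p (F i) A
  ... | inj₁ (e , _) = inj₁ (trans (sym e) (trans (shifted i A) SA))
  ... | inj₂ (e , _) = inj₂ (trans (sym e) (trans (shifted i A) SA))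

  stars⇒F : ∀ i A → star k U A ≡ true → star k U (τ A) ≡ true → F i A ≡ true
  stars⇒F i A SA SτA with shift-dichotomy p (F i) A
  ... | inj₁ (e , _) = trans (sym e) (trans (shifted i A) SA)
  ... | inj₂ (_ , e) = trans (sym e) (trans (shifted i (τ A)) SτA)

  -- U and τ U share all but one element, and sets meeting U ∩ τ U belong to every F j:
  -- these complete A and B to a cross-matching.
  conflict : ∀ a b A B → a ≢ b → F a A ≡ true → F b B ≡ true →
    meets A U ≡ false → meets B (τ U) ≡ false → meets A B ≡ false → {P : Set} → P
  conflict a b A B a≢b FA FB AU BτU AB =
    ⊥-elim (crossFree G member disjoint)
    where
    open ≤-Reasoning
    Y : Subset n
    Y = U ∩ τ U
    v≤∣Y∣ : v ≤ ∣ Y ∣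
    v≤∣Y∣ = ≤-pred (subst (_≤ suc ∣ Y ∣) ∣U∣ (∩-swap p U))
    Q : Subset n
    Q = U ∪ (A ∪ B)
    Q-room : v * h + ∣ Q ∣ ≤ n
    Q-room = begin
      v * h + ∣ Q ∣                     ≤⟨ +-monoʳ-≤ (v * h) (≤-trans (∣∪∣≤ U (A ∪ B)) (+-monoʳ-≤ ∣ U ∣ (∣∪∣≤ A B))) ⟩
      v * h + (∣ U ∣ + (∣ A ∣ + ∣ B ∣)) ≡⟨ cong₂ (λ x y → v * h + (x + y)) ∣U∣ (cong₂ _+_ (uniform a A FA) (uniform b B FB)) ⟩
      v * h + (suc v + (suc h + suc h)) ≤⟨ m≤m+n (v * h + (suc v + (suc h + suc h))) (h + v + suc v + suc (suc h)) ⟩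
      v * h + (suc v + (suc h + suc h)) + (h + v + suc v + suc (suc h)) ≡⟨ arith v h ⟩
      suc v * suc h + (suc v + suc v) + (suc h + suc h + suc h) ≤⟨ room ⟩
      n ∎
      where
      arith : ∀ v h → v * h + (suc v + (suc h + suc h)) + (h + v + suc v + suc (suc h)) ≡ suc v * suc h + (suc v + suc v) + (suc h + suc h + suc h)
      arith = solve-∀
    enumeration = enumerate v Y v≤∣Y∣
    fillers = disjointAvoiding v h Q Q-room
    e : Fin v → Fin n
    e = proj₁ enumeration
    e∈Y : ∀ i → lookup U (e i) ≡ true × lookup (τ U) (e i) ≡ true
    e∈Y i = ∧-true (trans (sym (lookup-zipWith _∧_ (e i) U (τ U))) (proj₁ (proj₂ enumeration) i))
    W : Fin v → Subset n
    W = proj₁ fillers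
    W∩U : ∀ i → meets (W i) U ≡ false
    W∩U i = proj₁ (disjoint-∪⁻ (W i) U (A ∪ B) (proj₁ (proj₂ (proj₂ fillers)) i))
    W∩AB : ∀ i → meets (W i) A ≡ false × meets (W i) B ≡ false
    W∩AB i = disjoint-∪⁻ (W i) A B (proj₂ (disjoint-∪⁻ (W i) U (A ∪ B) (proj₁ (proj₂ (proj₂ fillers)) i)))
    e∉W : ∀ i j → lookup (W i) (e j) ≡ false
    e∉W i j = disjoint⇒lookup (e j) (W i) U (W∩U i) (proj₁ (e∈Y j))
    -- The point `e i` lies in `U` and in `τ U`. So `V i` is in both stars, hence in every family,
    -- while `A` misses `e i` because it avoids `U`, and `B` because it avoids `τ U`.
    V : Fin v → Subset n
    V i = ⁅ e i ⁆ ∪ W i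
    ∣V∣ : ∀ i → ∣ V i ∣ ≡ suc h
    ∣V∣ i = trans (∣⁅x⁆∪A∣ (e i) (W i) (e∉W i i)) (cong suc (proj₁ (proj₂ fillers) i))
    V-meets : ∀ i D → lookup D (e i) ≡ true → meets (V i) D ≡ true
    V-meets i D e∈C = trans (meets-∪ ⁅ e i ⁆ (W i) D) (cong (_∨ meets (W i) D) (trans (meets-⁅⁆ˡ (e i) D) e∈C))
    V-avoids : ∀ i D → lookup D (e i) ≡ false → meets (W i) D ≡ false → meets (V i) D ≡ false
    V-avoids i D e∉C WC = ∪-disjoint ⁅ e i ⁆ (W i) D (trans (meets-⁅⁆ˡ (e i) D) e∉C) WC
    V∩A : ∀ i → meets (V i) A ≡ false
    V∩A i = V-avoids i A (disjoint⇒lookup (e i) A U AU (proj₁ (e∈Y i))) (proj₁ (W∩AB i))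
    V∩B : ∀ i → meets (V i) B ≡ false
    V∩B i = V-avoids i B (disjoint⇒lookup (e i) B (τ U) BτU (proj₂ (e∈Y i))) (proj₂ (W∩AB i))
    V∩V : ∀ i j → i ≢ j → meets (V i) (V j) ≡ false
    V∩V i j i≢j = disjoint-∪ (V i) ⁅ e j ⁆ (W j)
      (trans (meets-sym (V i) ⁅ e j ⁆) (disjoint-∪ ⁅ e j ⁆ ⁅ e i ⁆ (W i)
        (meets-⁅⁆ (λ eq → i≢j (sym (proj₂ (proj₂ enumeration) j i eq)))) (trans (meets-⁅⁆ˡ (e j) (W i)) (e∉W i j))))
      (V-avoids i (W j) (e∉W j i) (proj₂ (proj₂ (proj₂ fillers)) i j i≢j))
    F∋V : ∀ j i → F j (V i) ≡ true
    F∋V j i = stars⇒F j (V i)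
      (∧-intro (≡⇒sized k (V i) (∣V∣ i)) (V-meets i U (proj₁ (e∈Y i))))
      (trans (sym (star-τ (V i))) (∧-intro (≡⇒sized k (V i) (∣V∣ i)) (V-meets i (τ U) (proj₂ (e∈Y i)))))
    b′ : Fin (suc v)
    b′ = punchOut a≢b
    -- Removing `a` and `b` from the `v + 2` indices leaves exactly as many as there are points
    -- `e i`.
    index : ∀ j (a≢j : a ≢ j) → b ≢ j → Fin v
    index j a≢j b≢j = punchOut (b≢j ∘ punchOut-injective a≢b a≢j)
    G : Fin (suc (suc v)) → Subset n
    G j with a ≟ᶠ j | b ≟ᶠ j
    ... | yes _  | _      = A
    ... | no _   | yes _  = B
    ... | no a≢j | no b≢j = V (index j a≢j b≢j)
    member : ∀ j → F j (G j) ≡ true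
    member j with a ≟ᶠ j | b ≟ᶠ j
    ... | yes refl | _        = FA
    ... | no _     | yes refl = FB
    ... | no a≢j   | no b≢j   = F∋V j _
    disjoint : ∀ i j → i ≢ j → meets (G i) (G j) ≡ false
    disjoint i j i≢j with a ≟ᶠ i | b ≟ᶠ i | a ≟ᶠ j | b ≟ᶠ j
    ... | yes refl | _        | yes refl | _        = ⊥-elim (i≢j refl)
    ... | yes refl | _        | no _     | yes refl = AB
    ... | yes refl | _        | no _     | no _     = trans (meets-sym A _) (V∩A _)
    ... | no _     | yes refl | yes refl | _        = trans (meets-sym B A) AB
    ... | no _     | yes refl | no _     | yes refl = ⊥-elim (i≢j refl)
    ... | no _     | yes refl | no _     | no _     = trans (meets-sym B _) (V∩B _)
    ... | no _     | no _     | yes refl | _        = V∩A _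
    ... | no _     | no _     | no _     | yes refl = V∩B _
    ... | no a≢i   | no b≢i   | no a≢j   | no b≢j   = V∩V _ _
      (λ eq → i≢j (punchOut-injective a≢i a≢j (punchOut-injective (b≢i ∘ punchOut-injective a≢b a≢i) (b≢j ∘ punchOut-injective a≢b a≢j) eq)))

  -- The point `z` is the only contact with `U`; the other `h` points are fresh.
  generic : ∀ z D → lookup U z ≡ true → lookup (τ U) z ≡ false → meets D U ≡ false → ∣ D ∣ ≤ k + k →
    ∃ λ V → star k U V ≡ true × meets V (τ U) ≡ false × meets V D ≡ false
  generic z D z∈U z∉τU CU C≤ with avoiding h (U ∪ (τ U ∪ D)) (begin
      h + ∣ U ∪ (τ U ∪ D) ∣         ≤⟨ +-monoʳ-≤ h (≤-trans (∣∪∣≤ U (τ U ∪ D)) (+-monoʳ-≤ ∣ U ∣ (∣∪∣≤ (τ U) D))) ⟩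
      h + (∣ U ∣ + (∣ τ U ∣ + ∣ D ∣)) ≤⟨ +-monoʳ-≤ h (+-mono-≤ (≤-reflexive ∣U∣) (+-mono-≤ (≤-reflexive (trans (∣swap∣ p U) ∣U∣)) C≤)) ⟩
      h + (w + (w + (k + k)))       ≤⟨ m≤m+n (h + (w + (w + (k + k)))) (suc (w * suc h)) ⟩
      h + (w + (w + (k + k))) + suc (w * suc h) ≡⟨ arith h w ⟩
      w * suc h + (w + w) + (suc h + suc h + suc h) ≤⟨ room ⟩
      n                             ∎)
    where
    open ≤-Reasoning
    arith : ∀ h w → h + (w + (w + (suc h + suc h))) + suc (w * suc h) ≡ w * suc h + (w + w) + (suc h + suc h + suc h)
    arith = solve-∀
  ... | Z , ∣Z∣ , ZQ with disjoint-∪⁻ Z U (τ U ∪ D) ZQ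
  ... | ZU , Zrest with disjoint-∪⁻ Z (τ U) D Zrest
  ... | ZτU , ZC = ⁅ z ⁆ ∪ Z
    , ∧-intro (≡⇒sized k (⁅ z ⁆ ∪ Z) (trans (∣⁅x⁆∪A∣ z Z (disjoint⇒lookup z Z U ZU z∈U)) (cong suc ∣Z∣)))
              (trans (meets-∪ ⁅ z ⁆ Z U) (cong (_∨ meets Z U) (trans (meets-⁅⁆ˡ z U) z∈U)))
    , ∪-disjoint ⁅ z ⁆ Z (τ U) (trans (meets-⁅⁆ˡ z (τ U)) z∉τU) ZτU
    , ∪-disjoint ⁅ z ⁆ Z D (trans (meets-⁅⁆ˡ z D) (disjoint⇒lookup z D U CU z∈U)) ZC

  -- Take a generic `V` through `z`, disjoint from `A` and `D`. Either `V` or `τ V` lies in `F a′`,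
  -- and `V` itself would be in conflict with `A`. Thus a set avoiding `U` in one family yields one
  -- in any other family, with its position under control.
  transfer : ∀ z a a′ A D → lookup U z ≡ true → lookup (τ U) z ≡ false → a ≢ a′ → F a A ≡ true →
    meets A U ≡ false → meets D U ≡ false → ∣ D ∣ ≡ k →
    ∃ λ V → F a′ (τ V) ≡ true × meets V (τ U) ≡ false × meets V D ≡ false
  transfer z a a′ A D z∈U z∉τU a≢a′ FA AU CU ∣C∣ =
    pick (generic z (A ∪ D) z∈U z∉τU (∪-disjoint A D U AU CU)
           (≤-trans (∣∪∣≤ A D) (≤-reflexive (cong₂ _+_ (uniform a A FA) ∣C∣))))
    where
    pick : (∃ λ V → star k U V ≡ true × meets V (τ U) ≡ false × meets V (A ∪ D) ≡ false) →
      ∃ λ V → F a′ (τ V) ≡ true × meets V (τ U) ≡ false × meets V D ≡ false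
    pick (V , SV , VτU , VAC) with disjoint-∪⁻ V A D VAC | star⇒F a′ V SV
    ... | VA , VC | inj₁ FV  = conflict a a′ A V a≢a′ FA FV AU VτU (trans (meets-sym A V) VA)
    ... | VA , VC | inj₂ FτV = V , FτV , VτU , VC

  -- `A` avoids `U` and `B` avoids `τ U`, but they may intersect or share a family, so `conflict`
  -- does not apply at once. `transfer` replaces `A` by a set `τ V` that still avoids `U` and is
  -- disjoint from `B`; for this `V` is chosen disjoint from `τ B`.
  not-both-exceeded : ∀ a b A B → F a A ≡ true → star k U A ≡ false → F b B ≡ true → star k (τ U) B ≡ false → {P : Set} → P
  not-both-exceeded a b A B FA ¬SA FB ¬SB = go a b FA FB
    where
    disjoint-star : ∀ i A V → F i A ≡ true → star k V A ≡ false → meets A V ≡ false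
    disjoint-star i A V FA ¬S rewrite ≡⇒sized k A (uniform i A FA) = ¬S
    AU : meets A U ≡ false
    AU = disjoint-star a A U FA ¬SA
    BτU : meets B (τ U) ≡ false
    BτU = disjoint-star b B (τ U) FB ¬SB
    B∩U : meets B U ≡ true
    B∩U with F⇒star b B FB
    ... | inj₁ SB  = proj₂ (∧-true SB)
    ... | inj₂ SτB = true≢false SτB (trans (sym (star-τ B)) ¬SB)
    z-exists = meets⇒lookup B U B∩U
    z : Fin n
    z = proj₁ z-exists
    z∈U : lookup U z ≡ true
    z∈U = proj₂ (proj₂ z-exists)
    z∉τU : lookup (τ U) z ≡ false
    z∉τU = disjoint⇒lookup z (τ U) B (trans (meets-sym (τ U) B) BτU) (proj₁ (proj₂ z-exists))
    τB∩U : meets (τ B) U ≡ false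
    τB∩U = trans (meets-τ B U) BτU
    ∣τB∣ : ∣ τ B ∣ ≡ k
    ∣τB∣ = trans (∣swap∣ p B) (uniform b B FB)
    other : ∀ (a : Fin (suc w)) → ∃ λ a′ → a ≢ a′
    other a = punchIn a zero , (λ eq → punchInᵢ≢i a zero (sym eq))
    τ-disjoint : ∀ V → meets V (τ B) ≡ false → meets (τ V) B ≡ false
    τ-disjoint V VτB = trans (meets-τ V B) VτB
    τ-outside : ∀ V → meets V (τ U) ≡ false → meets (τ V) U ≡ false
    τ-outside V VτU = trans (meets-τ V U) VτU
    go : ∀ a b → F a A ≡ true → F b B ≡ true → {P : Set} → P
    go a b FA FB = first (other a)
      where
      first : (∃ λ a′ → a ≢ a′) → {P : Set} → P
      first (a′ , a≢a′) = second (transfer z a a′ A (τ B) z∈U z∉τU a≢a′ FA AU τB∩U ∣τB∣) (a′ ≟ᶠ b)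
        where
        second : (∃ λ V → F a′ (τ V) ≡ true × meets V (τ U) ≡ false × meets V (τ B) ≡ false) →
          Dec (a′ ≡ b) → {P : Set} → P
        second (V , FτV , VτU , VτB) (no a′≢b) =
          conflict a′ b (τ V) B a′≢b FτV FB (τ-outside V VτU) BτU (τ-disjoint V VτB)
        -- The replacement landed in the family of `B`; a second transfer brings it back to `a`,
        -- which is now known to differ from `b`.
        second (V , FτV , VτU , VτB) (yes refl) =
          third (transfer z a′ a (τ V) (τ B) z∈U z∉τU (a≢a′ ∘ sym) FτV (τ-outside V VτU) τB∩U ∣τB∣)
          where
          third : (∃ λ V₂ → F a (τ V₂) ≡ true × meets V₂ (τ U) ≡ false × meets V₂ (τ B) ≡ false) → {P : Set} → P
          third (V₂ , FτV₂ , V₂τU , V₂τB) =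
            conflict a b (τ V₂) B a≢a′ FτV₂ FB (τ-outside V₂ V₂τU) BτU (τ-disjoint V₂ V₂τB)

  Exceeds : Subset n → Set
  Exceeds V = ∃ λ i → ∃ λ A → F i A ≡ true × star k V A ≡ false

  exceeds? : ∀ V → Dec (Exceeds V)
  exceeds? V = any? (λ i → anySubset? (λ A → (F i A ≟ᵇ true) ×-dec (star k V A ≟ᵇ false)))

  -- If `A` is in the star but not in `F i`, then `τ A` is in `F i`, hence in the star as nothing
  -- exceeds it; and when both are in the star, `both` puts `A` into `F i`.
  exact : ∀ V →
    (∀ i A → star k V A ≡ true → F i A ≡ true ⊎ F i (τ A) ≡ true) →
    (∀ i A → star k V A ≡ true → star k V (τ A) ≡ true → F i A ≡ true) →
    ¬ Exceeds V → ∀ i A → F i A ≡ star k V A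
  exact V cover both ¬ex i A with F i A in FA | star k V A in SA
  ... | true  | true  = refl
  ... | false | false = refl
  ... | true  | false = ⊥-elim (¬ex (i , A , FA , SA))
  ... | false | true with cover i A SA
  ...   | inj₁ FA′ = trans (sym FA) FA′
  ...   | inj₂ FτA with star k V (τ A) in SτA
  ...     | true  = trans (sym FA) (both i A SA SτA)
  ...     | false = ⊥-elim (¬ex (i , τ A , FτA , SτA))

  unshift : ∃ λ V → ∣ V ∣ ≡ w × (∀ i A → F i A ≡ star k V A)
  unshift with exceeds? U
  ... | no ¬ex = U , ∣U∣ , exact U star⇒F stars⇒F ¬ex
  ... | yes (a , A , FA , ¬SA) with exceeds? (τ U)
  ...   | yes (b , B , FB , ¬SB) = not-both-exceeded a b A B FA ¬SA FB ¬SB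
  ...   | no ¬ex = τ U , trans (∣swap∣ p U) ∣U∣ , exact (τ U) cover both ¬ex
    where
    cover : ∀ i A → star k (τ U) A ≡ true → F i A ≡ true ⊎ F i (τ A) ≡ true
    cover i A SA with star⇒F i (τ A) (trans (sym (star-τ A)) SA)
    ... | inj₁ FτA  = inj₂ FτA
    ... | inj₂ FττA = inj₁ (trans (cong (F i) (sym (ττ A))) FττA)
    both : ∀ i A → star k (τ U) A ≡ true → star k (τ U) (τ A) ≡ true → F i A ≡ true
    both i A SA SτA = stars⇒F i A
      (trans (cong (star k U) (sym (ττ A))) (trans (sym (star-τ (τ A))) SτA)) (trans (sym (star-τ A)) SA)

unshift-star : ∀ {n} w h p → w * suc h + (w + w) + (suc h + suc h + suc h) ≤ n →
  (F : Fin (suc w) → Family n) → (∀ i A → F i A ≡ true → ∣ A ∣ ≡ suc h) → CrossFree F →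
  (U : Subset n) → ∣ U ∣ ≡ w → (∀ i A → shiftAt p (F i) A ≡ star (suc h) U A) →
  ∃ λ V → ∣ V ∣ ≡ w × (∀ i A → F i A ≡ star (suc h) V A)
unshift-star zero h p room F uniform crossFree U ∣U∣ shifted = U , ∣U∣ , λ i A → trans (empty i A) (sym (noStar A))
  where
  noStar : ∀ A → star (suc h) U A ≡ false
  noStar A = ¬true⇒false (λ SA → 1+n≰n (subst (1 ≤_) ∣U∣ (meets⇒nonempty A U (proj₂ (∧-true SA)))))
  empty : ∀ i A → F i A ≡ false
  empty i A with shift-dichotomy p (F i) A
  ... | inj₁ (e , _) = trans (sym e) (trans (shifted i A) (noStar A))
  ... | inj₂ (_ , e) = trans (sym e) (trans (shifted i (swapAt p A)) (noStar (swapAt p A)))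
unshift-star {n} (suc v) h p room F uniform crossFree U ∣U∣ shifted =
  Unshift.unshift n v h p room F uniform crossFree U ∣U∣ shifted

-- The threshold and the reduction to shifted families

uniform-shift : ∀ {n} k p (F : Family n) → (∀ A → F A ≡ true → ∣ A ∣ ≡ k) →
  ∀ A → shiftAt p F A ≡ true → ∣ A ∣ ≡ k
uniform-shift k p F uniform A FA with shift-true p F A FA
... | inj₁ FA′       = uniform A FA′
... | inj₂ (_ , FτA) = trans (sym (∣swap∣ p A)) (uniform (swapAt p A) FτA)

-- A cross-matching of the shifted families is one of the original families, unless some A i
-- uses p where only its swap belongs to F i; then no other A j contains p, and all can be swapped.
crossFree-shift : ∀ {t n} p (F : Fin t → Family n) → CrossFree F → CrossFree (λ i → shiftAt p (F i))
crossFree-shift p F crossFree A member disjoint with all? (λ i → F i (A i) ≟ᵇ true)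
... | yes allF = crossFree A allF disjoint
... | no ¬allF with ¬∀⟶∃¬ _ _ (λ i → F i (A i) ≟ᵇ true) ¬allF
... | i , ¬FA with shift-true p (F i) (A i) (member i)
... | inj₁ FA = ¬FA FA
... | inj₂ (p∈Ai , FτAi) = crossFree (λ j → swapAt p (A j)) member′
        (λ j j′ j≢j′ → trans (meets-swap p (A j) (A j′)) (disjoint j j′ j≢j′))
  where
  member′ : ∀ j → F j (swapAt p (A j)) ≡ true
  member′ j with i ≟ᶠ j
  ... | yes refl = FτAi
  ... | no i≢j   = shift-true-outside p (F j) (A j) (member j) (disjoint⇒bitAt p (A i) (A j) (disjoint i j i≢j) p∈Ai)

sumFin : ∀ t → (Fin t → ℕ) → ℕ
sumFin zero    f = 0
sumFin (suc t) f = f zero + sumFin t (f ∘ suc)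

sumFin-mono : ∀ t {f g : Fin t → ℕ} → (∀ i → f i ≤ g i) → sumFin t f ≤ sumFin t g
sumFin-mono zero    le = z≤n
sumFin-mono (suc t) le = +-mono-≤ (le zero) (sumFin-mono t (le ∘ suc))

sumFin-squeeze : ∀ t {f g : Fin t → ℕ} → (∀ i → f i ≤ g i) → sumFin t g ≤ sumFin t f → ∀ i → g i ≤ f i
sumFin-squeeze (suc t) {f} {g} f≤g le zero =
  +-cancelʳ-≤ (sumFin t (g ∘ suc)) _ _ (≤-trans le (+-monoʳ-≤ (f zero) (sumFin-mono t (f≤g ∘ suc))))
sumFin-squeeze (suc t) {f} {g} f≤g le (suc i) = sumFin-squeeze t (f≤g ∘ suc)
  (+-cancelˡ-≤ (g zero) _ _ (≤-trans le (+-monoˡ-≤ (sumFin t (f ∘ suc)) (f≤g zero)))) i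

starSize : (n w k : ℕ) → ℕ
starSize n w k = binom n k ∸ binom (n ∸ w) k

card-star≡ : ∀ {n w} k (U : Subset n) → ∣ U ∣ ≡ w → card (star k U) ≡ starSize n w k
card-star≡ {n} {w} k U ∣U∣ = trans (sym (m+n∸n≡m (card (star k U)) (binom (n ∸ w) k)))
  (cong (_∸ binom (n ∸ w) k) (card-star k U (n ∸ w)
    (trans (cong (n ∸ w +_) ∣U∣) (m∸n+n≡m (subst (_≤ n) ∣U∣ (∣p∣≤n U))))))

crossing : ∀ {P : ℕ → Set} → (∀ x → Dec (P x)) → ∀ fuel a → P a → ¬ P (a + fuel) →
  ∃ λ x → a ≤ x × P x × ¬ P (suc x)
crossing {P} P? zero a Pa ¬P = ⊥-elim (¬P (subst P (sym (+-identityʳ a)) Pa))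
crossing {P} P? (suc fuel) a Pa ¬P with P? (suc a)
... | no ¬Psa = a , ≤-refl , Pa , ¬Psa
... | yes Psa with crossing P? fuel (suc a) Psa (¬P ∘ subst P (sym (+-suc a fuel)))
... | x , a<x , Px , ¬Psx = x , <⇒≤ a<x , Px , ¬Psx

*-^-distrib : ∀ x y c → (x * y) ^ c ≡ x ^ c * y ^ c
*-^-distrib x y zero    = refl
*-^-distrib x y (suc c) = trans (cong (x * y *_) (*-^-distrib x y c)) (arith x y (x ^ c) (y ^ c))
  where
  arith : ∀ x y a b → x * y * (a * b) ≡ x * a * (y * b)
  arith = solve-∀

-- Here w = t - 1 and c = w + 2. The scale X is the largest one with (2 X^c + c + 2) k ≤ m,
-- whence m ≤ κ₀ X^c k; n > threshold k ensures X ≥ X₀ and room for generic sets in unshift-star.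
κ₀ X₀ threshold : ℕ → ℕ
κ₀ w = 2 * 2 ^ suc (suc w) + (3 + suc w)
X₀ w = suc (8 * κ₀ w)
threshold w = (2 * X₀ w ^ suc (suc w) + 1 + suc (suc w)) + 1 + (w + (w + w) + 3)

module Scale (w m h : ℕ)
  (room : (2 * X₀ w ^ suc (suc w) + 1 + suc (suc w)) * suc h + suc h ≤ m) where

  open ≤-Reasoning

  k c : ℕ
  k = suc h
  c = suc (suc w)

  Fits : ℕ → Set
  Fits X = (2 * X ^ c + 1 + c) * k + k ≤ m

  ¬Fits : ¬ Fits (X₀ w + m)
  ¬Fits fits = 1+n≰n (begin
    suc m                                 ≤⟨ s≤s (m≤n+m m (8 * κ₀ w)) ⟩
    X₀ w + m                              ≡⟨ sym (*-identityʳ _) ⟩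
    (X₀ w + m) * 1                        ≤⟨ *-monoʳ-≤ (X₀ w + m) (m^n>0 (X₀ w + m) (suc w)) ⟩
    (X₀ w + m) ^ c                        ≤⟨ m≤n*m _ 2 ⟩
    2 * (X₀ w + m) ^ c                    ≤⟨ ≤-trans (m≤m+n _ 1) (m≤m+n _ c) ⟩
    2 * (X₀ w + m) ^ c + 1 + c            ≤⟨ m≤m*n _ k ⟩
    (2 * (X₀ w + m) ^ c + 1 + c) * k      ≤⟨ m≤m+n _ k ⟩
    (2 * (X₀ w + m) ^ c + 1 + c) * k + k  ≤⟨ fits ⟩
    m                                     ∎)

  scale : ∃ λ X → X₀ w ≤ X × Fits X × m ≤ κ₀ w * X ^ c * k
  scale with crossing {Fits} (λ X → _ ≤? m) m (X₀ w) room ¬Fits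
  ... | X , X₀≤X , fits , ¬fits = X , X₀≤X , fits , (begin
    -- `suc X` no longer fits, and `suc X ≤ 2 * X` expresses its bound in `X ^ c`; this is the
    -- origin of the `2 ^ c` in `κ₀`.
    m                                          ≤⟨ <⇒≤ (≰⇒> ¬fits) ⟩
    (2 * suc X ^ c + 1 + c) * k + k            ≡⟨ arith (suc X ^ c) (suc w) k ⟩
    (2 * suc X ^ c + (3 + suc w) * 1) * k      ≤⟨ *-monoˡ-≤ k (+-mono-≤
        (*-monoʳ-≤ 2 (≤-trans (^-monoˡ-≤ c 1+X≤2X) (≤-reflexive (*-^-distrib 2 X c))))
        (*-monoʳ-≤ (3 + suc w) (m^n>0 X c))) ⟩
    (2 * (2 ^ c * X ^ c) + (3 + suc w) * X ^ c) * k ≡⟨ arith₂ (2 ^ c) (X ^ c) (3 + suc w) k ⟩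
    κ₀ w * X ^ c * k                           ∎)
    where
    1≤X : 1 ≤ X
    1≤X = ≤-trans (s≤s z≤n) X₀≤X
    instance
      X≢0 : NonZero X
      X≢0 = >-nonZero 1≤X
    1+X≤2X : suc X ≤ 2 * X
    1+X≤2X = ≤-trans (+-monoˡ-≤ X 1≤X) (≤-reflexive (cong (X +_) (sym (+-identityʳ X))))
    arith : ∀ x v k → (2 * x + 1 + suc v) * k + k ≡ (2 * x + (3 + v) * 1) * k
    arith = solve-∀
    arith₂ : ∀ y x v k → (2 * (y * x) + v * x) * k ≡ (2 * y + v) * x * k
    arith₂ = solve-∀

2≤X₀ : ∀ w → 2 ≤ X₀ w
2≤X₀ w = s≤s (≤-trans (≤-trans (s≤s z≤n) (m≤n+m (3 + suc w) (2 * 2 ^ suc (suc w)))) (m≤n*m (κ₀ w) 8))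

module Extremal (w h n : ℕ) (enough : suc h * threshold w < n) where

  open ≤-Reasoning

  k base : ℕ
  k = suc h
  base = 2 * X₀ w ^ suc (suc w) + 1 + suc (suc w)

  splitThreshold : ∀ b w k → k * (b + 1 + (w + (w + w) + 3)) ≡ (b * k + k) + (k * w + (k * w + k * w + (k + k + k)))
  splitThreshold = solve-∀

  enough′ : (base * k + k) + (k * w + (k * w + k * w + (k + k + k))) ≤ n
  enough′ = subst (_≤ n) (splitThreshold base w k) (<⇒≤ enough)

  unshiftRoom : w * suc h + (w + w) + (suc h + suc h + suc h) ≤ n
  unshiftRoom = begin
    w * k + (w + w) + (k + k + k) ≡⟨ +-assoc (w * k) (w + w) (k + k + k) ⟩
    w * k + (w + w + (k + k + k)) ≤⟨ +-mono-≤ (≤-reflexive (*-comm w k)) (+-monoˡ-≤ (k + k + k) (+-mono-≤ (m≤n*m w k) (m≤n*m w k))) ⟩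
    k * w + (k * w + k * w + (k + k + k)) ≤⟨ m≤n+m _ (base * k + k) ⟩
    (base * k + k) + (k * w + (k * w + k * w + (k + k + k))) ≤⟨ enough′ ⟩
    n ∎

  coreRoom : w + (base * k + k) ≤ n
  coreRoom = begin
    w + (base * k + k)     ≡⟨ +-comm w _ ⟩
    base * k + k + w       ≤⟨ +-monoʳ-≤ (base * k + k) (≤-trans (m≤n*m w k) (m≤m+n (k * w) (k * w + k * w + (k + k + k)))) ⟩
    (base * k + k) + (k * w + (k * w + k * w + (k + k + k))) ≤⟨ enough′ ⟩
    n ∎

  Stars : (Fin (suc w) → Family n) → Set
  Stars F = ∃ λ U → ∣ U ∣ ≡ w × (∀ i A → F i A ≡ star k U A)

  closed⇒stars : ∀ m → n ≡ w + m → (F : Fin (suc w) → Family n) →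
    (∀ i A → F i A ≡ true → ∣ A ∣ ≡ k) → CrossFree F → (∀ i → Closed (F i)) →
    (∀ i → starSize n w k ≤ card (F i)) → Stars F
  closed⇒stars m refl F uniform crossFree closed large =
    build (Scale.scale w m h (+-cancelˡ-≤ w _ _ coreRoom))
    where
    build : (∃ λ X → X₀ w ≤ X × Scale.Fits w m h (+-cancelˡ-≤ w _ _ coreRoom) X × m ≤ κ₀ w * X ^ suc (suc w) * k) → Stars F
    build (X , X₀≤X , fits , m≤) = initial w m , ∣initial∣ w m ,
      ClosedCase.isStar w m h X (κ₀ w) (≤-trans (2≤X₀ w) X₀≤X) X₀≤X fits m≤ F uniform crossFree closed
        (λ i → ≤-trans (≤-reflexive (card-star≡ k (initial w m) (∣initial∣ w m))) (large i))

  total : (Fin (suc w) → Family n) → ℕ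
  total F = sumFin (suc w) (λ i → weight 0 0 (F i))

  -- Induction on the total weight. The shift acts on all families at once, as `crossFree-shift`
  -- demands, and `unshift-star` carries the conclusion back. If no position lowers the total, none
  -- lowers a single weight, so every family is closed.
  stars : ∀ N (F : Fin (suc w) → Family n) → total F < N →
    (∀ i A → F i A ≡ true → ∣ A ∣ ≡ k) → CrossFree F → (∀ i → starSize n w k ≤ card (F i)) → Stars F
  stars (suc N) F (s≤s bound) uniform crossFree large
    with any? {n = n} (λ p → total (λ i → shiftAt (toℕ p) (F i)) <? total F)
  ... | yes (p , lighter) = undo (stars N F′ (<-≤-trans lighter bound)
          (λ i → uniform-shift k (toℕ p) (F i) (uniform i)) (crossFree-shift (toℕ p) F crossFree)
          (λ i → ≤-trans (large i) (≤-reflexive (sym (card-shift (toℕ p) (F i))))))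
    where
    F′ : Fin (suc w) → Family n
    F′ i = shiftAt (toℕ p) (F i)
    undo : Stars F′ → Stars F
    undo (U , ∣U∣ , F′≡) = unshift-star w h (toℕ p) unshiftRoom F uniform crossFree U ∣U∣ F′≡
  ... | no ¬lighter = closed⇒stars (n ∸ w) (sym (m+[n∸m]≡n (≤-trans (m≤m+n w _) coreRoom)))
          F uniform crossFree closed large
    where
    closed : ∀ i → Closed (F i)
    closed i p with p <? n
    ... | no p≮n  = closedAt-≥ p (F i) (≮⇒≥ p≮n)
    ... | yes p<n = weight-closed 0 0 p (F i) (sumFin-squeeze (suc w) (λ j → weight-shift 0 0 p (F j))
      (≮⇒≥ (λ lighter → ¬lighter (fromℕ< p<n , subst (λ q → total (λ j → shiftAt q (F j)) < total F) (sym (toℕ-fromℕ< p<n)) lighter))) i)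

-- Translation to the stated form

minOver≤ : ∀ t (f : Fin t → ℕ) i → minOver t f ≤ f i
minOver≤ (suc zero)    f zero    = ≤-refl
minOver≤ (suc (suc t)) f zero    = m⊓n≤m (f zero) _
minOver≤ (suc (suc t)) f (suc i) = ≤-trans (m⊓n≤n (f zero) _) (minOver≤ (suc t) (f ∘ suc) i)

minOver-const : ∀ t (f : Fin (suc t) → ℕ) M → (∀ i → f i ≡ M) → minOver (suc t) f ≡ M
minOver-const zero    f M eq = eq zero
minOver-const (suc t) f M eq = trans (cong₂ _⊓_ (eq zero) (minOver-const t (f ∘ suc) M (eq ∘ suc))) (⊓-idem M)

meets⇒Nonempty : ∀ {n} (A B : Subset n) → meets A B ≡ true → Nonempty (A ∩ B)
meets⇒Nonempty A B AB with meets⇒lookup A B AB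
... | x , p , q = x , lookup⇒[]= x (A ∩ B) (trans (lookup-zipWith _∧_ x A B) (∧-intro p q))

Nonempty⇒meets : ∀ {n} (A B : Subset n) → Nonempty (A ∩ B) → meets A B ≡ true
Nonempty⇒meets A B (x , x∈) with ∧-true (trans (sym (lookup-zipWith _∧_ x A B)) ([]=⇒lookup x∈))
... | p , q = lookup⇒meets x A B p q

star⇒IsStarOf : ∀ {n} k (U : Subset n) (F : Family n) → (∀ A → F A ≡ star k U A) → IsStarOf k U F
star⇒IsStarOf k U F F≡ A =
  (λ FA → sized⇒≡ k A (proj₁ (∧-true (trans (sym (F≡ A)) FA))) ,
          meets⇒Nonempty A U (proj₂ (∧-true {sized k A} (trans (sym (F≡ A)) FA)))) ,
  (λ (∣A∣ , AU) → trans (F≡ A) (∧-intro (≡⇒sized k A ∣A∣) (Nonempty⇒meets A U AU)))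

card-IsStarOf : ∀ {n w} k (U : Subset n) (F : Family n) → ∣ U ∣ ≡ w → IsStarOf k U F → card F ≡ starSize n w k
card-IsStarOf k U F ∣U∣ isStar = trans (≤-antisym
  (card-mono (λ A FA → ∧-intro (≡⇒sized k A (proj₁ (proj₁ (isStar A) FA))) (Nonempty⇒meets A U (proj₂ (proj₁ (isStar A) FA)))))
  (card-mono (λ A SA → proj₂ (isStar A) (sized⇒≡ k A (proj₁ (∧-true SA)) , meets⇒Nonempty A U (proj₂ (∧-true {sized k A} SA))))))
  (card-star≡ k U ∣U∣)

theorem3p1 : (t : ℕ) → ∃ λ (c₀ : ℕ) →
    ∀ (n k : ℕ) → 1 ≤ k → k * c₀ < n →
    (F : Fin t → Family n) →
    (∀ i → IsUniform k (F i)) →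
    CrossFreeOfMatching F →
    (minOver t (λ i → ∣ F i ∣ᶠ) ≤ n C k ∸ (n ∸ (t ∸ 1)) C k)
    × ((minOver t (λ i → ∣ F i ∣ᶠ) ≡ n C k ∸ (n ∸ (t ∸ 1)) C k)
    ⇔ (∃ λ (U : Subset n) → ∣ U ∣ ≡ t ∸ 1 × (∀ i → IsStarOf k U (F i))))
-- For `t = 0` the empty tuple is a cross-matching.
theorem3p1 zero = 0 , λ n k _ _ F _ noMatching → ⊥-elim (noMatching ((λ ()) , (λ ()) , (λ ())))
theorem3p1 (suc w) = threshold w , bound
  where
  bound : ∀ (n k : ℕ) → 1 ≤ k → k * threshold w < n → (F : Fin (suc w) → Family n) →
    (∀ i → IsUniform k (F i)) → CrossFreeOfMatching F →
    (minOver (suc w) (λ i → ∣ F i ∣ᶠ) ≤ n C k ∸ (n ∸ w) C k)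
    × ((minOver (suc w) (λ i → ∣ F i ∣ᶠ) ≡ n C k ∸ (n ∸ w) C k)
    ⇔ (∃ λ (U : Subset n) → ∣ U ∣ ≡ w × (∀ i → IsStarOf k U (F i))))
  bound n k@(suc h) 1≤k enough F uniform noMatching = upper , mk⇔ (isStars ∘ ≤-reflexive ∘ sym) size
    where
    sizes : Fin (suc w) → ℕ
    sizes i = ∣ F i ∣ᶠ

    M : ℕ
    M = n C k ∸ (n ∸ w) C k

    M≡ : starSize n w k ≡ M
    M≡ = cong₂ _∸_ (binom≡C n k) (binom≡C (n ∸ w) k)

    crossFree : CrossFree F
    crossFree A member disjoint = noMatching (A , member ,
      λ i j i≢j ne → true≢false (Nonempty⇒meets (A i) (A j) ne) (disjoint i j i≢j))

    isStars : M ≤ minOver (suc w) sizes → ∃ λ (U : Subset n) → ∣ U ∣ ≡ w × (∀ i → IsStarOf k U (F i))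
    isStars M≤ with Extremal.stars w h n enough _ F ≤-refl uniform crossFree
      (λ i → subst₂ _≤_ (sym M≡) (∣∣ᶠ≡card (F i)) (≤-trans M≤ (minOver≤ (suc w) sizes i)))
    ... | U , ∣U∣ , F≡ = U , ∣U∣ , λ i → star⇒IsStarOf k U (F i) (F≡ i)

    size : (∃ λ (U : Subset n) → ∣ U ∣ ≡ w × (∀ i → IsStarOf k U (F i))) → minOver (suc w) sizes ≡ M
    size (U , ∣U∣ , isStar) = minOver-const w sizes M
      (λ i → trans (∣∣ᶠ≡card (F i)) (trans (card-IsStarOf k U (F i) ∣U∣ (isStar i)) M≡))

    upper : minOver (suc w) sizes ≤ M
    upper with minOver (suc w) sizes ≤? M
    ... | yes le = le
    -- A minimum above `M` would also make all families one star, and then the minimum is `M`.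
    ... | no nle = ≤-reflexive (size (isStars (<⇒≤ (≰⇒> nle))))
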